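{- Let $p$ be an odd prime, $1\le m<n$, $\bar B\subseteq[n]\setminus[m]$ with $|\bar B|=b\ge1$, and let $I$ be the generalized order ideal of $\mathbb{GH}(m,n)$, of type (U) (unsaturated) or (S) (saturated), in which every element of $[m]\cup\bar B$ has multiplicity $p-1$ and all other elements have multiplicity $0$. Let $f:\mathbb{F}_p^n\to\mathbb{F}_p$ be the characteristic function of $I(\mathbb{GP})\setminus\{0\}$ and, for $s\in\mathbb{F}_p$, $u\in\mathbb{F}_p^n$, let $c(s,u)=(sf(x)+u\cdot x)_{x\in\mathbb{F}_p^n\setminus0}$. Put $Q=(p-1)p^{n-1}$, and write $u=(v,w)$ with $v\in\mathbb{F}_p^m$, $w\in\mathbb{F}_p^{n-m}$, $k=\mathrm{wt}(v)$, $\sigma=\sum_{i\le m}v_i\in\mathbb{F}_p$, and $\delta=1$ if the restriction of $w$ to the coordinates in $\bar B$ is zero, $\delta=0$ otherwise. Then $\mathrm{wt}(c(0,u))=Q$ for $u\ne0$, $\mathrm{wt}(c(s,0))=|I(\mathbb{GP})|-1$ for $s\ne0$, and for $s\ne0$, $u\ne0$, \[ \mathrm{wt}(c(s,u))=Q-1+p^m[v=0]+\Phi,\qquad \Phi=\begin{cases}(-1)^k(p-1)^{m-k}(p^b\delta-1)&\text{in case (U)},\\ (p^b\delta-1)\big([\sigma=0]-[\sigma=s]\big)&\text{in case (S)}.\end{cases} \]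
   Context: $[n]=\{1,\dots,n\}$; $[\,\cdot\,]$ applied to a condition is $1$ if it holds and $0$ otherwise; $u\cdot x=\sum_i u_ix_i$; $\mathrm{wt}$ is Hamming weight. Generalized order ideals: $[n]_{p-1}$ is the multiset in which each $i\in[n]$ has multiplicity $p-1$. A sub-multiset $J$ is identified with its multiplicity vector $(J_1,\dots,J_n)\in\{0,\dots,p-1\}^n=\mathbb{F}_p^n$; $J\subseteq J'$ means $J_i\le J'_i$ (as integers) for all $i$; $\bar J=\{i:J_i\ne0\}$. The hierarchical poset $\mathbb{H}(m,n)$ on $[n]$ has as its only strict relations $i\prec j$ for all $i\in[m]$, $j\in[n]\setminus[m]$; $\mathbb{GH}(m,n)$ denotes $[n]_{p-1}$ together with this order. $J$ is an unsaturated generalized order ideal (U) if $\bar J$ is an order ideal (down-closed subset) of $\mathbb{H}(m,n)$; it is a saturated generalized order ideal (S) if moreover $J_i=p-1$ whenever $j\in\bar J$ and $i\prec j$. For a generalized order ideal $I$ of either type, $I(\mathbb{GP})\subseteq\mathbb{F}_p^n$ is the set of all generalized order ideals of the same type contained in $I$. -}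

module Defs where

open import Data.Bool.Base using (if_then_else_)
open import Data.Fin.Base as Fin using (Fin; toℕ)
open import Data.Fin.Properties as Fin using (all?)
open import Data.Fin.Subset using (Subset; _∈_)
open import Data.Fin.Subset.Properties using (_∈?_)
open import Data.Integer.Base as ℤ using (ℤ; +_; 0ℤ; 1ℤ; -1ℤ)
open import Data.List.Base as List using (List; []; _∷_; length; filter; cartesianProductWith)
open import Data.Nat.Base as ℕ using (ℕ; zero; suc; NonZero; _<_; _≤_; _∸_)
open import Data.Nat.DivMod using (_mod_)
import Data.Nat.Properties as ℕ
open import Data.Product.Base using (_×_)
open import Data.Vec.Base as Vec using (Vec; []; _∷_; lookup)
import Data.Vec.Properties as Vec
import Relation.Binary.Construct.StrictToNonStrict as StrictToNonStrict
open import Relation.Binary.PropositionalEquality using (_≡_)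
open import Relation.Nullary.Decidable
  using (Dec; does; ¬?; _×-dec_; _⊎-dec_; _→-dec_)
open import Relation.Unary using (Pred; Decidable)
open import Level using (0ℓ)

private
  variable
    m n p : ℕ

-- For prime p this is the field of p elements. Its elements are the residues
-- 0, …, p-1 themselves, so that a vector over it is also a multiplicity vector.

𝔽 : ℕ → Set
𝔽 p = Fin p

module _ {p : ℕ} .{{_ : NonZero p}} where

  infixl 6 _+ᶠ_
  infixl 7 _*ᶠ_

  0ᶠ 1ᶠ : 𝔽 p
  0ᶠ = 0 mod p
  1ᶠ = 1 mod p

  _+ᶠ_ _*ᶠ_ : 𝔽 p → 𝔽 p → 𝔽 p
  a +ᶠ b = (toℕ a ℕ.+ toℕ b) mod p
  a *ᶠ b = (toℕ a ℕ.* toℕ b) mod p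

  0⃗ : Vec (𝔽 p) n
  0⃗ = Vec.replicate _ 0ᶠ

  infix 4 _≟⃗_

  _≟⃗_ : (u v : Vec (𝔽 p) n) → Dec (u ≡ v)
  _≟⃗_ = Vec.≡-dec Fin._≟_

  Σᶠ : Vec (𝔽 p) n → 𝔽 p
  Σᶠ = Vec.foldr _ _+ᶠ_ 0ᶠ

  infix 8 _·_

  _·_ : Vec (𝔽 p) n → Vec (𝔽 p) n → 𝔽 p
  u · x = Σᶠ (Vec.zipWith _*ᶠ_ u x)

  wt : Vec (𝔽 p) n → ℕ
  wt = Vec.count (λ a → ¬? (a Fin.≟ 0ᶠ))

-- Every vector of 𝔽 p ^ n occurs exactly once.

vectors : ∀ p n → List (Vec (𝔽 p) n)
vectors p zero    = [] ∷ []
vectors p (suc n) = cartesianProductWith _∷_ (List.allFin p) (vectors p n)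

nonzeroVectors : ∀ p .{{_ : NonZero p}} n → List (Vec (𝔽 p) n)
nonzeroVectors p n = filter (λ x → ¬? (x ≟⃗ 0⃗)) (vectors p n)

card : {P : Pred (Vec (𝔽 p) n) 0ℓ} → Decidable P → ℕ
card {p} {n} P? = length (filter P? (vectors p n))

⟦_⟧ : {P : Set} → Dec P → ℤ
⟦ P? ⟧ = if does P? then 1ℤ else 0ℤ

module _ {p : ℕ} .{{_ : NonZero p}} where

  -- The indicator takes its values 0 and 1 in 𝔽 p.
  characteristic : {P : Pred (Vec (𝔽 p) n) 0ℓ} → Decidable P → Vec (𝔽 p) n → 𝔽 p
  characteristic P? x = if does (P? x) then 1ᶠ else 0ᶠ

  -- The coordinates are indexed by the positions in nonzeroVectors p n.
  codeword : (Vec (𝔽 p) n → 𝔽 p) → 𝔽 p → Vec (𝔽 p) n →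
             Vec (𝔽 p) (length (nonzeroVectors p n))
  codeword f s u =
    Vec.map (λ x → s *ᶠ f x +ᶠ u · x) (Vec.fromList (nonzeroVectors p _))

-- The hierarchical poset on Fin n. Indices start at 0, so [m] consists of the
-- i with toℕ i < m.

infix 4 _≺[_]_ _⪯[_]_

_≺[_]_ : Fin n → ℕ → Fin n → Set
i ≺[ m ] j = toℕ i < m × m ≤ toℕ j

_⪯[_]_ : Fin n → ℕ → Fin n → Set
i ⪯[ m ] j = StrictToNonStrict._≤_ _≡_ (_≺[ m ]_) i j

IsOrderIdeal : ℕ → Subset n → Set
IsOrderIdeal m A = ∀ i j → j ∈ A → i ⪯[ m ] j → i ∈ A

_≺[_]?_ : (i : Fin n) (m : ℕ) (j : Fin n) → Dec (i ≺[ m ] j)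
i ≺[ m ]? j = toℕ i ℕ.<? m ×-dec m ℕ.≤? toℕ j

_⪯[_]?_ : (i : Fin n) (m : ℕ) (j : Fin n) → Dec (i ⪯[ m ] j)
i ⪯[ m ]? j = StrictToNonStrict.decidable _≡_ (_≺[ m ]_) Fin._≟_ (_≺[ m ]?_) i j

isOrderIdeal? : ∀ m → Decidable (IsOrderIdeal {n} m)
isOrderIdeal? m A = all? λ i → all? λ j → j ∈? A →-dec i ⪯[ m ]? j →-dec i ∈? A

data IdealType : Set where
  unsaturated saturated : IdealType

infix 4 _⊑_ _⊑?_

_⊑_ : Vec (𝔽 p) n → Vec (𝔽 p) n → Set
J ⊑ J′ = ∀ i → lookup J i Fin.≤ lookup J′ i

_⊑?_ : (J J′ : Vec (𝔽 p) n) → Dec (J ⊑ J′)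
J ⊑? J′ = all? λ i → lookup J i Fin.≤? lookup J′ i

module _ {p : ℕ} .{{_ : NonZero p}} where

  support : Vec (𝔽 p) n → Subset n
  support = Vec.map λ a → does (¬? (a Fin.≟ 0ᶠ))

  Saturated : ℕ → Vec (𝔽 p) n → Set
  Saturated m J = ∀ i j → j ∈ support J → i ≺[ m ] j → toℕ (lookup J i) ≡ p ∸ 1

  IsIdeal : IdealType → ℕ → Vec (𝔽 p) n → Set
  IsIdeal unsaturated m J = IsOrderIdeal m (support J)
  IsIdeal saturated   m J = IsOrderIdeal m (support J) × Saturated m J

  saturated? : ∀ m → Decidable (Saturated {n} m)
  saturated? m J = all? λ i → all? λ j →
    j ∈? support J →-dec i ≺[ m ]? j →-dec toℕ (lookup J i) ℕ.≟ p ∸ 1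

  isIdeal? : ∀ τ m → Decidable (IsIdeal {n} τ m)
  isIdeal? unsaturated m J = isOrderIdeal? m (support J)
  isIdeal? saturated   m J = isOrderIdeal? m (support J) ×-dec saturated? m J

  SubIdeal : IdealType → ℕ → Vec (𝔽 p) n → Pred (Vec (𝔽 p) n) 0ℓ
  SubIdeal τ m I J = IsIdeal τ m J × J ⊑ I

  subIdeal? : ∀ τ m (I : Vec (𝔽 p) n) → Decidable (SubIdeal τ m I)
  subIdeal? τ m I J = isIdeal? τ m J ×-dec J ⊑? I

  -- Multiplicity p-1 on [m] ∪ B, 0 elsewhere.
  fullIdeal : ℕ → Subset n → Vec (𝔽 p) n
  fullIdeal m B = Vec.tabulate λ i →
    if does (toℕ i ℕ.<? m ⊎-dec i ∈? B) then (p ∸ 1) mod p else 0ᶠ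

  -- For B disjoint from [m] this only concerns the last n - m coordinates.
  VanishesOn : Subset n → Vec (𝔽 p) n → Set
  VanishesOn B u = ∀ j → j ∈ B → lookup u j ≡ 0ᶠ

  vanishesOn? : (B : Subset n) → Decidable (VanishesOn B)
  vanishesOn? B u = all? λ j → j ∈? B →-dec lookup u j Fin.≟ 0ᶠ

  -- b stands for the size of B, and δ for the 0/1 indicator that u vanishes on B.
  Φ : IdealType → 𝔽 p → Vec (𝔽 p) m → (b : ℕ) (δ : ℤ) → ℤ
  Φ {m = m} unsaturated s v b δ =
    (-1ℤ ℤ.^ k) ℤ.* (+ (p ∸ 1)) ℤ.^ (m ∸ k) ℤ.* (+ (p ℕ.^ b) ℤ.* δ ℤ.- 1ℤ)
    where k = wt v
  Φ saturated s v b δ =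
    (+ (p ℕ.^ b) ℤ.* δ ℤ.- 1ℤ) ℤ.* (⟦ σ Fin.≟ 0ᶠ ⟧ ℤ.- ⟦ σ Fin.≟ s ⟧)
    where σ = Σᶠ v

{-# OPTIONS --safe #-}
module Submission where

-- Throughout, wt (c s u) is written as a sum over all of 𝔽 p ^ n of integer
-- indicators. Put h a = [a = 0] - [s + a = 0]. At the coordinate x the
-- indicator [x ≠ 0] [s f(x) + u · x ≠ 0] equals
--
--   [u · x ≠ 0] + [x ∈ I(GP)] h(u · x) - [x = 0] h(0),
--
-- because f is 1 exactly on I(GP) minus the origin (coordinate-indicator).
-- Summing the first term gives Q for u ≠ 0, since a nonzero linear form takes
-- every value equally often (sumᵛ-linear), and the last term gives -h(0), which
-- is -1 for s ≠ 0. For s = 0 the function h vanishes, and for u = 0 the middle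
-- sum is |I(GP)| h(0); this settles the first two claims.
--
-- In general let Y be the set of values that a coordinate in [m] may take below
-- a nonzero coordinate: the nonzero residues in the unsaturated case and only
-- p - 1 in the saturated one. For C contained in [n] minus [m], consider the box
-- of all x with the first m coordinates in Y and the others zero outside C.
-- Then I(GP) is the union of
--   * the box with all residues in place of Y, and C = ∅,
--   * the box of Y with C = B,
-- and these two meet in the box of Y with C = ∅ (⟦subIdeal?⟧), so that the
-- middle sum is a signed sum of three sums over boxes.
--
-- The function h has total sum 0, as a ↦ s + a permutes 𝔽 p. Hence the sum of
-- h(c + w a) over all a is p h(c) if w = 0, and 0 otherwise. A free coordinate
-- thus multiplies h by p [w = 0] and a nonzero one by p [w = 0] - 1, while a
-- coordinate fixed at p - 1 translates the argument by -w. Going through the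
-- coordinates one by one (sumᵛ-box), the box of Y and C contributes
-- p^|C| [u = 0 on C] times the sum of h(v · y) over y in Y^m, and the latter is
--   * p^m [v = 0] h(0) if Y consists of all residues,
--   * (-1)^k (p-1)^(m-k) h(0) if Y consists of the nonzero residues,
--   * h(-σ) = [σ = 0] - [σ = s] if Y consists of p - 1 alone.

open import Defs
open import Algebra.Bundles using (CommutativeSemigroup)
import Algebra.Properties.CommutativeSemigroup as CommutativeSemigroupProperties
open import Data.Bool.Base using (true; false; if_then_else_)
open import Data.Fin.Base as Fin using (Fin; zero; suc; toℕ; punchOut)
open import Data.Fin.Permutation using (Permutation; permutation)
import Data.Fin.Properties as Fin
open import Data.Fin.Subset using (Subset; _∈_; _∉_; ∣_∣; ⊥)
open import Data.Fin.Subset.Properties using (_∈?_; ∉⊥; ∣⊥∣≡0; drop-there)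
open import Data.Integer.Base as ℤ using (ℤ; +_; 0ℤ; 1ℤ; -1ℤ)
import Data.Integer.Properties as ℤ
open import Data.Integer.Tactic.RingSolver using (solve-∀)
open import Algebra.Properties.Semiring.Sum ℤ.+-*-semiring
  using (sum; sum-cong-≗; ∑-distrib-+; *-distribˡ-sum; sum-permute)
open import Data.List.Base as List
  using (List; []; _∷_; _++_; length; filter; cartesianProductWith; tabulate)
open import Data.Nat.Base as ℕ
  using (ℕ; zero; suc; NonZero; _≤_; _<_; _∸_; _^_; _*_; z≤n; s≤s; z<s)
open import Data.Nat.Divisibility using (_∣_; divides; ∣⇒≤)
open import Data.Nat.DivMod
open import Data.Nat.Primality using (Prime; euclidsLemma; prime⇒nonTrivial)
import Data.Nat.Properties as ℕ
open import Data.Nat.Properties using (<⇒≤)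
open import Data.Product.Base using (_×_; _,_; proj₁; proj₂; ∃)
open import Data.Sum.Base using (_⊎_; inj₁; inj₂; [_,_]′)
open import Data.Unit.Base using (⊤; tt)
open import Data.Vec.Base as Vec using (Vec; []; _∷_; lookup; truncate; here; there)
import Data.Vec.Properties as Vec
open import Function.Base using (_∘_; id)
open import Function.Definitions using (Injective)
open import Level using (0ℓ)
open import Relation.Binary.PropositionalEquality
open import Relation.Nullary.Decidable
  using (Dec; yes; no; does; ¬?; _×-dec_; _⊎-dec_; _→-dec_; dec-true; dec-false; decidable-stable)
open import Relation.Nullary.Negation using (¬_; contradiction)
open import Relation.Unary using (Pred; Decidable)

private
  variable
    m n : ℕ

-- Arithmetic of residues modulo p

-- Pigeonhole: a missed value could be punched out of the codomain.
injective⇒surjective : ∀ {n} {f : Fin n → Fin n} → Injective _≡_ _≡_ f → ∀ y → ∃ λ x → f x ≡ y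
injective⇒surjective {suc n} {f} inj y with Fin.any? (λ x → f x Fin.≟ y)
... | yes hit = hit
... | no miss = contradiction (Fin.injective⇒≤ g-inj) ℕ.1+n≰n
  where
  f≢y : ∀ x → y ≢ f x
  f≢y x eq = miss (x , sym eq)
  g-inj : Injective _≡_ _≡_ (λ x → punchOut (f≢y x))
  g-inj eq = inj (Fin.punchOut-injective (f≢y _) (f≢y _) eq)

injective⇒permutation : ∀ {n} {f : Fin n → Fin n} → Injective _≡_ _≡_ f → Permutation n n
injective⇒permutation {f = f} inj =
  permutation f (proj₁ ∘ surj) (proj₂ ∘ surj) (λ x → inj (proj₂ (surj (f x))))
  where surj = injective⇒surjective inj

module _ {p : ℕ} .{{_ : NonZero p}} where

  toℕ-mod : ∀ k → toℕ (k mod p) ≡ k % p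
  toℕ-mod k = Fin.toℕ-fromℕ< (m%n<n k p)

  toℕ%p : (a : 𝔽 p) → toℕ a % p ≡ toℕ a
  toℕ%p a = m<n⇒m%n≡m (Fin.toℕ<n a)

  mod-cong : ∀ {k l} → k % p ≡ l % p → k mod p ≡ l mod p
  mod-cong {k} {l} eq = Fin.toℕ-injective (trans (toℕ-mod k) (trans eq (sym (toℕ-mod l))))

  mod-toℕ : (a : 𝔽 p) → toℕ a mod p ≡ a
  mod-toℕ a = Fin.toℕ-injective (trans (toℕ-mod (toℕ a)) (toℕ%p a))

  toℕ-0ᶠ : toℕ (0ᶠ {p}) ≡ 0
  toℕ-0ᶠ = trans (toℕ-mod 0) (m*n%n≡0 0 p)

  -- Reduction modulo p is a homomorphism of semirings onto 𝔽 p.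
  mod-+ : ∀ k l → k mod p +ᶠ l mod p ≡ (k ℕ.+ l) mod p
  mod-+ k l = mod-cong (trans
    (cong₂ (λ x y → (x ℕ.+ y) % p) (toℕ-mod k) (toℕ-mod l))
    (sym (%-distribˡ-+ k l p)))

  mod-* : ∀ k l → (k mod p) *ᶠ (l mod p) ≡ (k * l) mod p
  mod-* k l = mod-cong (trans
    (cong₂ (λ x y → (x * y) % p) (toℕ-mod k) (toℕ-mod l))
    (sym (%-distribˡ-* k l p)))

  +ᶠ-comm : (a b : 𝔽 p) → a +ᶠ b ≡ b +ᶠ a
  +ᶠ-comm a b = cong (_mod p) (ℕ.+-comm (toℕ a) (toℕ b))

  +ᶠ-assoc : (a b c : 𝔽 p) → (a +ᶠ b) +ᶠ c ≡ a +ᶠ (b +ᶠ c)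
  +ᶠ-assoc a b c = begin
    (a +ᶠ b) +ᶠ c                           ≡⟨ cong ((a +ᶠ b) +ᶠ_) (mod-toℕ c) ⟨
    (toℕ a ℕ.+ toℕ b) mod p +ᶠ toℕ c mod p  ≡⟨ mod-+ _ _ ⟩
    (toℕ a ℕ.+ toℕ b ℕ.+ toℕ c) mod p       ≡⟨ cong (_mod p) (ℕ.+-assoc (toℕ a) _ _) ⟩
    (toℕ a ℕ.+ (toℕ b ℕ.+ toℕ c)) mod p     ≡⟨ mod-+ _ _ ⟨
    toℕ a mod p +ᶠ (b +ᶠ c)                 ≡⟨ cong (_+ᶠ (b +ᶠ c)) (mod-toℕ a) ⟩
    a +ᶠ (b +ᶠ c)                           ∎
    where open ≡-Reasoning

  +ᶠ-identityˡ : (a : 𝔽 p) → 0ᶠ +ᶠ a ≡ a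
  +ᶠ-identityˡ a = trans (cong (λ z → (z ℕ.+ toℕ a) mod p) toℕ-0ᶠ) (mod-toℕ a)

  +ᶠ-identityʳ : (a : 𝔽 p) → a +ᶠ 0ᶠ ≡ a
  +ᶠ-identityʳ a = trans (+ᶠ-comm a 0ᶠ) (+ᶠ-identityˡ a)

  *ᶠ-zeroˡ : (a : 𝔽 p) → 0ᶠ *ᶠ a ≡ 0ᶠ
  *ᶠ-zeroˡ a = cong (λ z → (z * toℕ a) mod p) toℕ-0ᶠ

  *ᶠ-zeroʳ : (a : 𝔽 p) → a *ᶠ 0ᶠ ≡ 0ᶠ
  *ᶠ-zeroʳ a = cong (_mod p) (trans (cong (toℕ a *_) toℕ-0ᶠ) (ℕ.*-zeroʳ (toℕ a)))

  *ᶠ-identityʳ : (a : 𝔽 p) → a *ᶠ 1ᶠ ≡ a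
  *ᶠ-identityʳ a = begin
    a *ᶠ 1ᶠ                     ≡⟨ cong (_*ᶠ 1ᶠ) (mod-toℕ a) ⟨
    (toℕ a mod p) *ᶠ (1 mod p)  ≡⟨ mod-* (toℕ a) 1 ⟩
    (toℕ a * 1) mod p           ≡⟨ cong (_mod p) (ℕ.*-identityʳ (toℕ a)) ⟩
    toℕ a mod p                 ≡⟨ mod-toℕ a ⟩
    a                           ∎
    where open ≡-Reasoning

  -- The residue p - 1 stands for minus one.
  -1ᶠ : 𝔽 p
  -1ᶠ = (p ∸ 1) mod p

  a+a*-1≡0 : (a : 𝔽 p) → a +ᶠ a *ᶠ -1ᶠ ≡ 0ᶠ
  a+a*-1≡0 a = begin
    a +ᶠ a *ᶠ -1ᶠ
      ≡⟨ cong (λ z → z +ᶠ z *ᶠ -1ᶠ) (mod-toℕ a) ⟨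
    toℕ a mod p +ᶠ (toℕ a mod p) *ᶠ -1ᶠ
      ≡⟨ cong (toℕ a mod p +ᶠ_) (mod-* (toℕ a) (p ∸ 1)) ⟩
    toℕ a mod p +ᶠ (toℕ a * (p ∸ 1)) mod p
      ≡⟨ mod-+ (toℕ a) _ ⟩
    (toℕ a ℕ.+ toℕ a * (p ∸ 1)) mod p
      ≡⟨ cong (_mod p) (ℕ.*-suc (toℕ a) (p ∸ 1)) ⟨
    (toℕ a * suc (p ∸ 1)) mod p
      ≡⟨ cong (λ z → (toℕ a * z) mod p) (ℕ.suc-pred p) ⟩
    (toℕ a * p) mod p
      ≡⟨ mod-cong (trans (m*n%n≡0 (toℕ a) p) (sym (m*n%n≡0 0 p))) ⟩
    0ᶠ ∎
    where open ≡-Reasoning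

  %≡%⇒∣∸ : ∀ {x y} → x % p ≡ y % p → p ∣ y ∸ x
  %≡%⇒∣∸ {x} {y} eq = divides (y / p ∸ x / p) (begin
    y ∸ x
      ≡⟨ cong₂ _∸_ (m≡m%n+[m/n]*n y p) (m≡m%n+[m/n]*n x p) ⟩
    (y % p ℕ.+ y / p * p) ∸ (x % p ℕ.+ x / p * p)
      ≡⟨ cong (λ z → (y % p ℕ.+ y / p * p) ∸ (z ℕ.+ x / p * p)) eq ⟩
    (y % p ℕ.+ y / p * p) ∸ (y % p ℕ.+ x / p * p)
      ≡⟨ ℕ.[m+n]∸[m+o]≡n∸o (y % p) _ _ ⟩
    y / p * p ∸ x / p * p
      ≡⟨ ℕ.*-distribʳ-∸ p (y / p) (x / p) ⟨
    (y / p ∸ x / p) * p ∎)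
    where open ≡-Reasoning

  ∣∧<⇒≡0 : ∀ {k} → p ∣ k → k < p → k ≡ 0
  ∣∧<⇒≡0 {zero}  _   _   = refl
  ∣∧<⇒≡0 {suc k} p∣k k<p = contradiction (∣⇒≤ p∣k) (ℕ.<⇒≱ k<p)

  -- If a and b have the same image, p divides w (a ∸ b), hence a ∸ b by Euclid's
  -- lemma. As a ∸ b < p, this truncated difference is zero, that is a ≤ b.
  affine-injective : Prime p → (c w : 𝔽 p) → w ≢ 0ᶠ → Injective _≡_ _≡_ (λ a → c +ᶠ w *ᶠ a)
  affine-injective pr c w w≢0 {a} {b} eq =
    Fin.toℕ-injective (ℕ.≤-antisym (half a b eq) (half b a (sym eq)))
    where
    affine% : ∀ a → toℕ (c +ᶠ w *ᶠ a) ≡ (toℕ c ℕ.+ toℕ w * toℕ a) % p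
    affine% a = begin
      toℕ (c +ᶠ w *ᶠ a)                      ≡⟨ cong (λ z → toℕ (z +ᶠ w *ᶠ a)) (mod-toℕ c) ⟨
      toℕ (toℕ c mod p +ᶠ w *ᶠ a)            ≡⟨ cong toℕ (mod-+ (toℕ c) (toℕ w * toℕ a)) ⟩
      toℕ ((toℕ c ℕ.+ toℕ w * toℕ a) mod p)  ≡⟨ toℕ-mod _ ⟩
      (toℕ c ℕ.+ toℕ w * toℕ a) % p          ∎
      where open ≡-Reasoning
    p∤w : ¬ (p ∣ toℕ w)
    p∤w p∣w = w≢0 (Fin.toℕ-injective (trans (∣∧<⇒≡0 p∣w (Fin.toℕ<n w)) (sym toℕ-0ᶠ)))
    half : ∀ a b → c +ᶠ w *ᶠ a ≡ c +ᶠ w *ᶠ b → toℕ a ≤ toℕ b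
    half a b eq = [ (λ p∣w → contradiction p∣w p∤w)
                  , (λ p∣a∸b → ℕ.m∸n≡0⇒m≤n (∣∧<⇒≡0 p∣a∸b (ℕ.≤-<-trans (ℕ.m∸n≤m (toℕ a) (toℕ b)) (Fin.toℕ<n a))))
                  ]′ (euclidsLemma (toℕ w) (toℕ a ∸ toℕ b) pr p∣w*[a∸b])
      where
      difference : (toℕ c ℕ.+ toℕ w * toℕ a) ∸ (toℕ c ℕ.+ toℕ w * toℕ b) ≡ toℕ w * (toℕ a ∸ toℕ b)
      difference = trans (ℕ.[m+n]∸[m+o]≡n∸o (toℕ c) _ _) (sym (ℕ.*-distribˡ-∸ (toℕ w) (toℕ a) (toℕ b)))
      p∣w*[a∸b] : p ∣ toℕ w * (toℕ a ∸ toℕ b)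
      p∣w*[a∸b] = subst (p ∣_) difference
        (%≡%⇒∣∸ (trans (sym (affine% b)) (trans (cong toℕ (sym eq)) (affine% a))))

-- Indicators

module _ {P Q : Set} where

  ⟦⟧-cong : (P → Q) → (Q → P) → (P? : Dec P) (Q? : Dec Q) → ⟦ P? ⟧ ≡ ⟦ Q? ⟧
  ⟦⟧-cong f g (yes p) (yes q) = refl
  ⟦⟧-cong f g (yes p) (no ¬q) = contradiction (f p) ¬q
  ⟦⟧-cong f g (no ¬p) (yes q) = contradiction (g q) ¬p
  ⟦⟧-cong f g (no ¬p) (no ¬q) = refl

  ⟦⟧-× : (P? : Dec P) (Q? : Dec Q) → ⟦ P? ×-dec Q? ⟧ ≡ ⟦ P? ⟧ ℤ.* ⟦ Q? ⟧
  ⟦⟧-× (yes _) Q? = sym (ℤ.*-identityˡ ⟦ Q? ⟧)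
  ⟦⟧-× (no _)  Q? = refl

module _ {P : Set} where

  ⟦⟧-true : P → (P? : Dec P) → ⟦ P? ⟧ ≡ 1ℤ
  ⟦⟧-true p (yes _) = refl
  ⟦⟧-true p (no ¬p) = contradiction p ¬p

  ⟦⟧-false : ¬ P → (P? : Dec P) → ⟦ P? ⟧ ≡ 0ℤ
  ⟦⟧-false ¬p (yes p) = contradiction p ¬p
  ⟦⟧-false ¬p (no _)  = refl

  ⟦⟧-¬ : (P? : Dec P) → ⟦ ¬? P? ⟧ ≡ 1ℤ ℤ.+ -1ℤ ℤ.* ⟦ P? ⟧
  ⟦⟧-¬ (yes _) = refl
  ⟦⟧-¬ (no _)  = refl

-- If X is the union and C the intersection of A and B.
⟦⟧-inclusion-exclusion :
  {X A B C : Set} → (X → A ⊎ B) → (A ⊎ B → X) → (C → A × B) → (A × B → C) →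
  (X? : Dec X) (A? : Dec A) (B? : Dec B) (C? : Dec C) →
  ⟦ X? ⟧ ≡ ⟦ A? ⟧ ℤ.+ ⟦ B? ⟧ ℤ.+ -1ℤ ℤ.* ⟦ C? ⟧
⟦⟧-inclusion-exclusion x⇒ ⇒x c⇒ ⇒c X? (yes a) (yes b) C?
  rewrite ⟦⟧-true (⇒x (inj₁ a)) X? | ⟦⟧-true (⇒c (a , b)) C? = refl
⟦⟧-inclusion-exclusion x⇒ ⇒x c⇒ ⇒c X? (yes a) (no ¬b) C?
  rewrite ⟦⟧-true (⇒x (inj₁ a)) X? | ⟦⟧-false (¬b ∘ proj₂ ∘ c⇒) C? = refl
⟦⟧-inclusion-exclusion x⇒ ⇒x c⇒ ⇒c X? (no ¬a) (yes b) C?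
  rewrite ⟦⟧-true (⇒x (inj₂ b)) X? | ⟦⟧-false (¬a ∘ proj₁ ∘ c⇒) C? = refl
⟦⟧-inclusion-exclusion x⇒ ⇒x c⇒ ⇒c X? (no ¬a) (no ¬b) C?
  rewrite ⟦⟧-false ([ ¬a , ¬b ]′ ∘ x⇒) X? | ⟦⟧-false (¬a ∘ proj₁ ∘ c⇒) C? = refl

-- Finite sums of integers

sum-const : ∀ n z → sum {n} (λ _ → z) ≡ + n ℤ.* z
sum-const zero    z = refl
sum-const (suc n) z = trans (cong (ℤ._+_ z) (sum-const n z)) (sym (ℤ.suc-* (+ n) z))

-- Summing against the indicator of a single index evaluates there.
sum-point : ∀ {n} (g : Fin n → ℤ) b → sum (λ a → ⟦ a Fin.≟ b ⟧ ℤ.* g a) ≡ g b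
sum-point {suc n} g zero = begin
  1ℤ ℤ.* g zero ℤ.+ sum {n} (λ _ → 0ℤ)
    ≡⟨ cong₂ ℤ._+_ (ℤ.*-identityˡ (g zero)) (trans (sum-const n 0ℤ) (ℤ.*-zeroʳ (+ n))) ⟩
  g zero ℤ.+ 0ℤ
    ≡⟨ ℤ.+-identityʳ _ ⟩
  g zero ∎
  where open ≡-Reasoning
sum-point g (suc b) = trans (ℤ.+-identityˡ _) (sum-point (g ∘ suc) b)

sum-indicator : ∀ {n} (b : Fin n) → sum (λ a → ⟦ a Fin.≟ b ⟧) ≡ 1ℤ
sum-indicator b = trans (sum-cong-≗ λ a → sym (ℤ.*-identityʳ ⟦ a Fin.≟ b ⟧)) (sum-point (λ _ → 1ℤ) b)

-- The sum of g over all of 𝔽 p ^ n, coordinate by coordinate.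
sumᵛ : ∀ {p n} → (Vec (𝔽 p) n → ℤ) → ℤ
sumᵛ {n = zero}  g = g []
sumᵛ {n = suc _} g = sum λ a → sumᵛ λ x → g (a ∷ x)

module _ {p : ℕ} where

  sumᵛ-cong : ∀ {n} {g h : Vec (𝔽 p) n → ℤ} → (∀ x → g x ≡ h x) → sumᵛ g ≡ sumᵛ h
  sumᵛ-cong {zero}  eq = eq []
  sumᵛ-cong {suc n} eq = sum-cong-≗ λ a → sumᵛ-cong λ x → eq (a ∷ x)

  sumᵛ-+ : ∀ {n} (g h : Vec (𝔽 p) n → ℤ) → sumᵛ (λ x → g x ℤ.+ h x) ≡ sumᵛ g ℤ.+ sumᵛ h
  sumᵛ-+ {zero}  g h = refl
  sumᵛ-+ {suc n} g h = trans
    (sum-cong-≗ λ a → sumᵛ-+ (λ x → g (a ∷ x)) (λ x → h (a ∷ x)))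
    (∑-distrib-+ (λ a → sumᵛ (λ x → g (a ∷ x))) (λ a → sumᵛ (λ x → h (a ∷ x))))

  *-distribˡ-sumᵛ : ∀ {n} z (g : Vec (𝔽 p) n → ℤ) → z ℤ.* sumᵛ g ≡ sumᵛ (λ x → z ℤ.* g x)
  *-distribˡ-sumᵛ {zero}  z g = refl
  *-distribˡ-sumᵛ {suc n} z g = trans
    (*-distribˡ-sum z (λ a → sumᵛ (λ x → g (a ∷ x))))
    (sum-cong-≗ λ a → *-distribˡ-sumᵛ z (λ x → g (a ∷ x)))

  sumᵛ-point : .{{_ : NonZero p}} → ∀ {n} (g : Vec (𝔽 p) n → ℤ) v → sumᵛ (λ x → ⟦ x ≟⃗ v ⟧ ℤ.* g x) ≡ g v
  sumᵛ-point {zero}  g []      = ℤ.*-identityˡ _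
  sumᵛ-point {suc n} g (b ∷ v) = begin
    sum (λ a → sumᵛ (λ x → ⟦ (a ∷ x) ≟⃗ (b ∷ v) ⟧ ℤ.* g (a ∷ x)))
      ≡⟨ sum-cong-≗ (λ a → trans (sumᵛ-cong (λ x → trans
           (cong (ℤ._* g (a ∷ x)) (⟦⟧-× (a Fin.≟ b) (x ≟⃗ v)))
           (ℤ.*-assoc ⟦ a Fin.≟ b ⟧ ⟦ x ≟⃗ v ⟧ _)))
           (sym (*-distribˡ-sumᵛ ⟦ a Fin.≟ b ⟧ (λ x → ⟦ x ≟⃗ v ⟧ ℤ.* g (a ∷ x))))) ⟩
    sum (λ a → ⟦ a Fin.≟ b ⟧ ℤ.* sumᵛ (λ x → ⟦ x ≟⃗ v ⟧ ℤ.* g (a ∷ x)))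
      ≡⟨ sum-point _ b ⟩
    sumᵛ (λ x → ⟦ x ≟⃗ v ⟧ ℤ.* g (b ∷ x))
      ≡⟨ sumᵛ-point (λ x → g (b ∷ x)) v ⟩
    g (b ∷ v) ∎
    where open ≡-Reasoning

-- Sums over lists, through which cardinalities and weights become sumᵛ

sumˡ : {A : Set} → (A → ℤ) → List A → ℤ
sumˡ g = List.foldr (λ x z → g x ℤ.+ z) 0ℤ

module _ {A : Set} where

  sumˡ-++ : ∀ (g : A → ℤ) xs ys → sumˡ g (xs ++ ys) ≡ sumˡ g xs ℤ.+ sumˡ g ys
  sumˡ-++ g []       ys = sym (ℤ.+-identityˡ _)
  sumˡ-++ g (x ∷ xs) ys = trans (cong (ℤ._+_ (g x)) (sumˡ-++ g xs ys)) (sym (ℤ.+-assoc (g x) _ _))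

  sumˡ-map : ∀ {B : Set} (g : A → ℤ) (f : B → A) ys → sumˡ g (List.map f ys) ≡ sumˡ (g ∘ f) ys
  sumˡ-map g f []       = refl
  sumˡ-map g f (y ∷ ys) = cong (ℤ._+_ (g (f y))) (sumˡ-map g f ys)

  module _ {P : Pred A 0ℓ} (P? : Decidable P) where

    sumˡ-filter : ∀ g xs → sumˡ g (filter P? xs) ≡ sumˡ (λ x → ⟦ P? x ⟧ ℤ.* g x) xs
    sumˡ-filter g []       = refl
    sumˡ-filter g (x ∷ xs) with does (P? x)
    ... | true  = cong₂ ℤ._+_ (sym (ℤ.*-identityˡ (g x))) (sumˡ-filter g xs)
    ... | false = trans (sumˡ-filter g xs) (sym (ℤ.+-identityˡ _))

    count-sumˡ : ∀ {B : Set} (f : B → A) xs →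
      + Vec.count P? (Vec.map f (Vec.fromList xs)) ≡ sumˡ (λ x → ⟦ P? (f x) ⟧) xs
    count-sumˡ f []       = refl
    count-sumˡ f (x ∷ xs) with does (P? (f x))
    ... | true  = trans (ℤ.pos-+ 1 _) (cong (ℤ._+_ 1ℤ) (count-sumˡ f xs))
    ... | false = trans (count-sumˡ f xs) (sym (ℤ.+-identityˡ _))

  length-sumˡ : (xs : List A) → + length xs ≡ sumˡ (λ _ → 1ℤ) xs
  length-sumˡ []       = refl
  length-sumˡ (x ∷ xs) = trans (ℤ.pos-+ 1 _) (cong (ℤ._+_ 1ℤ) (length-sumˡ xs))

sumˡ-cartesianProductWith : ∀ {A B C : Set} {k} (g : C → ℤ) (f : A → B → C) (t : Fin k → A) ys →
  sumˡ g (cartesianProductWith f (tabulate t) ys) ≡ sum (λ i → sumˡ (g ∘ f (t i)) ys)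
sumˡ-cartesianProductWith {k = zero}  g f t ys = refl
sumˡ-cartesianProductWith {k = suc k} g f t ys = trans
  (sumˡ-++ g (List.map (f (t zero)) ys) _)
  (cong₂ ℤ._+_ (sumˡ-map g (f (t zero)) ys) (sumˡ-cartesianProductWith g f (t ∘ suc) ys))

sumˡ-vectors : ∀ {p} n (g : Vec (𝔽 p) n → ℤ) → sumˡ g (vectors p n) ≡ sumᵛ g
sumˡ-vectors zero    g = ℤ.+-identityʳ (g [])
sumˡ-vectors {p} (suc n) g = trans
  (sumˡ-cartesianProductWith g _∷_ id (vectors p n))
  (sum-cong-≗ λ a → sumˡ-vectors n (λ x → g (a ∷ x)))

card-sumᵛ : ∀ {p n} {P : Pred (Vec (𝔽 p) n) 0ℓ} (P? : Decidable P) → + card P? ≡ sumᵛ (λ x → ⟦ P? x ⟧)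
card-sumᵛ {p} {n} P? = begin
  + card P?
    ≡⟨ length-sumˡ (filter P? (vectors p n)) ⟩
  sumˡ (λ _ → 1ℤ) (filter P? (vectors p n))
    ≡⟨ sumˡ-filter P? (λ _ → 1ℤ) (vectors p n) ⟩
  sumˡ (λ x → ⟦ P? x ⟧ ℤ.* 1ℤ) (vectors p n)
    ≡⟨ sumˡ-vectors n _ ⟩
  sumᵛ (λ x → ⟦ P? x ⟧ ℤ.* 1ℤ)
    ≡⟨ sumᵛ-cong (λ x → ℤ.*-identityʳ ⟦ P? x ⟧) ⟩
  sumᵛ (λ x → ⟦ P? x ⟧) ∎
  where open ≡-Reasoning

wt-codeword : ∀ {p} .{{_ : NonZero p}} {n} (f : Vec (𝔽 p) n → 𝔽 p) s u →
  + wt (codeword f s u) ≡ sumᵛ (λ x → ⟦ ¬? (x ≟⃗ 0⃗) ⟧ ℤ.* ⟦ ¬? (s *ᶠ f x +ᶠ u · x Fin.≟ 0ᶠ) ⟧)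
wt-codeword {p} {n} f s u = begin
  + wt (codeword f s u)
    ≡⟨ count-sumˡ (λ a → ¬? (a Fin.≟ 0ᶠ)) _ (nonzeroVectors p n) ⟩
  sumˡ (λ x → ⟦ ¬? (s *ᶠ f x +ᶠ u · x Fin.≟ 0ᶠ) ⟧) (nonzeroVectors p n)
    ≡⟨ sumˡ-filter (λ x → ¬? (x ≟⃗ 0⃗)) _ (vectors p n) ⟩
  sumˡ (λ x → ⟦ ¬? (x ≟⃗ 0⃗) ⟧ ℤ.* ⟦ ¬? (s *ᶠ f x +ᶠ u · x Fin.≟ 0ᶠ) ⟧) (vectors p n)
    ≡⟨ sumˡ-vectors n _ ⟩
  sumᵛ (λ x → ⟦ ¬? (x ≟⃗ 0⃗) ⟧ ℤ.* ⟦ ¬? (s *ᶠ f x +ᶠ u · x Fin.≟ 0ᶠ) ⟧) ∎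
  where open ≡-Reasoning

module _ {p : ℕ} .{{_ : NonZero p}} where

  -- Linear forms

  ·-zeroˡ : (x : Vec (𝔽 p) n) → 0⃗ · x ≡ 0ᶠ
  ·-zeroˡ []      = refl
  ·-zeroˡ (a ∷ x) = trans (cong₂ _+ᶠ_ (*ᶠ-zeroˡ a) (·-zeroˡ x)) (+ᶠ-identityˡ 0ᶠ)

  ·-zeroʳ : (u : Vec (𝔽 p) n) → u · 0⃗ ≡ 0ᶠ
  ·-zeroʳ []      = refl
  ·-zeroʳ (w ∷ u) = trans (cong₂ _+ᶠ_ (*ᶠ-zeroʳ w) (·-zeroʳ u)) (+ᶠ-identityˡ 0ᶠ)

  +ᶠ-commutativeSemigroup : CommutativeSemigroup 0ℓ 0ℓ
  +ᶠ-commutativeSemigroup = record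
    { _∙_ = _+ᶠ_ {p}
    ; isCommutativeSemigroup = record
      { isSemigroup = record { isMagma = isMagma _+ᶠ_ ; assoc = +ᶠ-assoc }
      ; comm = +ᶠ-comm
      }
    }

  +ᶠ-cancelʳ : (a b c : 𝔽 p) → a +ᶠ c ≡ b +ᶠ c → a ≡ b
  +ᶠ-cancelʳ a b c eq = begin
    a                       ≡⟨ cancel a ⟨
    (a +ᶠ c) +ᶠ c *ᶠ -1ᶠ    ≡⟨ cong (_+ᶠ c *ᶠ -1ᶠ) eq ⟩
    (b +ᶠ c) +ᶠ c *ᶠ -1ᶠ    ≡⟨ cancel b ⟩
    b                       ∎
    where
    open ≡-Reasoning
    cancel : ∀ x → (x +ᶠ c) +ᶠ c *ᶠ -1ᶠ ≡ x
    cancel x = trans (+ᶠ-assoc x c _) (trans (cong (x +ᶠ_) (a+a*-1≡0 c)) (+ᶠ-identityʳ x))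

  -- The vector with all coordinates -1ᶠ has product minus Σᶠ v with v.
  Σᶠ+·-1≡0 : (v : Vec (𝔽 p) n) → Σᶠ v +ᶠ v · Vec.replicate n -1ᶠ ≡ 0ᶠ
  Σᶠ+·-1≡0 []      = +ᶠ-identityˡ 0ᶠ
  Σᶠ+·-1≡0 {suc n} (a ∷ v) = begin
    (a +ᶠ Σᶠ v) +ᶠ (a *ᶠ -1ᶠ +ᶠ v · Vec.replicate n -1ᶠ) ≡⟨ interchange a (Σᶠ v) _ _ ⟩
    (a +ᶠ a *ᶠ -1ᶠ) +ᶠ (Σᶠ v +ᶠ v · Vec.replicate n -1ᶠ) ≡⟨ cong₂ _+ᶠ_ (a+a*-1≡0 a) (Σᶠ+·-1≡0 v) ⟩
    0ᶠ +ᶠ 0ᶠ                                              ≡⟨ +ᶠ-identityˡ 0ᶠ ⟩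
    0ᶠ                                                    ∎
    where
    open ≡-Reasoning
    open CommutativeSemigroupProperties +ᶠ-commutativeSemigroup using (interchange)

  -- Sums of functions of a linear form

  sumᵛ-const : ∀ n z → sumᵛ {p} {n} (λ _ → z) ≡ + (p ^ n) ℤ.* z
  sumᵛ-const zero    z = sym (ℤ.*-identityˡ z)
  sumᵛ-const (suc n) z = begin
    sum {p} (λ _ → sumᵛ {p} {n} (λ _ → z)) ≡⟨ sum-const p _ ⟩
    + p ℤ.* sumᵛ {p} {n} (λ _ → z)         ≡⟨ cong (+ p ℤ.*_) (sumᵛ-const n z) ⟩
    + p ℤ.* (+ (p ^ n) ℤ.* z)              ≡⟨ ℤ.*-assoc (+ p) (+ (p ^ n)) z ⟨
    + p ℤ.* + (p ^ n) ℤ.* z                ≡⟨ cong (ℤ._* z) (ℤ.pos-* p (p ^ n)) ⟨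
    + (p ^ suc n) ℤ.* z                    ∎
    where open ≡-Reasoning

  +0ᶠ* : (c a : 𝔽 p) → c +ᶠ 0ᶠ *ᶠ a ≡ c
  +0ᶠ* c a = trans (cong (c +ᶠ_) (*ᶠ-zeroˡ a)) (+ᶠ-identityʳ c)

  module _ (pr : Prime p) where

    sum-affine : ∀ c w (g : 𝔽 p → ℤ) → w ≢ 0ᶠ → sum (λ a → g (c +ᶠ w *ᶠ a)) ≡ sum g
    sum-affine c w g w≢0 = sym (sum-permute g (injective⇒permutation (affine-injective pr c w w≢0)))

    -- A nonzero linear form takes each value p ^ n times on 𝔽 p ^ suc n.
    sumᵛ-linear : ∀ c (u : Vec (𝔽 p) (suc n)) (g : 𝔽 p → ℤ) → u ≢ 0⃗ →
                  sumᵛ (λ x → g (c +ᶠ u · x)) ≡ + (p ^ n) ℤ.* sum g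
    sumᵛ-linear {n} c (w ∷ u) g wu≢0 = trans
      (sum-cong-≗ λ a → sumᵛ-cong λ x → cong g (sym (+ᶠ-assoc c (w *ᶠ a) (u · x))))
      (split n u wu≢0)
      where
      open ≡-Reasoning
      -- If u vanishes, then w does not, and the first coordinate alone already
      -- takes all values equally often; otherwise the remaining coordinates do.
      split : ∀ n (u : Vec (𝔽 p) n) → w ∷ u ≢ 0⃗ →
              sum (λ a → sumᵛ (λ x → g ((c +ᶠ w *ᶠ a) +ᶠ u · x))) ≡ + (p ^ n) ℤ.* sum g
      split n u wu≢0 with u ≟⃗ 0⃗
      split n u wu≢0 | yes refl = begin
        sum (λ a → sumᵛ {n = n} (λ x → g ((c +ᶠ w *ᶠ a) +ᶠ 0⃗ · x)))
          ≡⟨ sum-cong-≗ (λ a → trans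
               (sumᵛ-cong {n = n} (λ x → cong g (trans
                 (cong ((c +ᶠ w *ᶠ a) +ᶠ_) (·-zeroˡ x)) (+ᶠ-identityʳ (c +ᶠ w *ᶠ a)))))
               (sumᵛ-const n (g (c +ᶠ w *ᶠ a)))) ⟩
        sum (λ a → + (p ^ n) ℤ.* g (c +ᶠ w *ᶠ a))
          ≡⟨ *-distribˡ-sum (+ (p ^ n)) (λ a → g (c +ᶠ w *ᶠ a)) ⟨
        + (p ^ n) ℤ.* sum (λ a → g (c +ᶠ w *ᶠ a))
          ≡⟨ cong (+ (p ^ n) ℤ.*_) (sum-affine c w g (λ w≡0 → wu≢0 (cong (_∷ 0⃗) w≡0))) ⟩
        + (p ^ n) ℤ.* sum g ∎
      split zero    [] wu≢0 | no u≢0 = contradiction refl u≢0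
      split (suc n) u  wu≢0 | no u≢0 = begin
        sum (λ a → sumᵛ (λ x → g ((c +ᶠ w *ᶠ a) +ᶠ u · x)))
          ≡⟨ sum-cong-≗ (λ a → sumᵛ-linear (c +ᶠ w *ᶠ a) u g u≢0) ⟩
        sum {p} (λ a → + (p ^ n) ℤ.* sum g)
          ≡⟨ sum-const p _ ⟩
        + p ℤ.* (+ (p ^ n) ℤ.* sum g)
          ≡⟨ ℤ.*-assoc (+ p) (+ (p ^ n)) (sum g) ⟨
        + p ℤ.* + (p ^ n) ℤ.* sum g
          ≡⟨ cong (ℤ._* sum g) (ℤ.pos-* p (p ^ n)) ⟨
        + (p ^ suc n) ℤ.* sum g ∎

  -- Boxes

  Full : Pred (𝔽 p) 0ℓ
  Full _ = ⊤

  full? : Decidable Full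
  full? _ = yes tt

  -- The vectors whose first m coordinates lie in Y and whose other coordinates
  -- vanish outside C.
  Box : Pred (𝔽 p) 0ℓ → ℕ → Subset n → Pred (Vec (𝔽 p) n) 0ℓ
  Box Y m C x = ∀ i → (toℕ i < m → Y (lookup x i)) × (m ≤ toℕ i → i ∉ C → lookup x i ≡ 0ᶠ)

  module _ {Y : Pred (𝔽 p) 0ℓ} (Y? : Decidable Y) where

    box? : ∀ m (C : Subset n) → Decidable (Box Y m C)
    box? m C x = Fin.all? λ i →
      (toℕ i ℕ.<? m →-dec Y? (lookup x i)) ×-dec
      (m ℕ.≤? toℕ i →-dec ¬? (i ∈? C) →-dec lookup x i Fin.≟ 0ᶠ)

    -- The next three lemmas split off the first coordinate, which lies in the
    -- prefix, in C, or in the rest; the last two lemmas concern an empty prefix.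
    box?-prefix : ∀ m (C : Subset n) a x →
      ⟦ box? (suc m) (false ∷ C) (a ∷ x) ⟧ ≡ ⟦ Y? a ⟧ ℤ.* ⟦ box? m C x ⟧
    box?-prefix m C a x = trans
      (⟦⟧-cong
        (λ b → proj₁ (b zero) z<s , λ i → (λ i<m → proj₁ (b (suc i)) (s≤s i<m)) ,
                                        λ m≤i i∉C → proj₂ (b (suc i)) (s≤s m≤i) (i∉C ∘ drop-there))
        (λ { (ya , b) zero → (λ _ → ya) , λ ()
           ; (ya , b) (suc i) → (λ { (s≤s i<m) → proj₁ (b i) i<m }) ,
                                λ { (s≤s m≤i) i∉C → proj₂ (b i) m≤i (i∉C ∘ there) } })
        (box? (suc m) (false ∷ C) (a ∷ x)) (Y? a ×-dec box? m C x))
      (⟦⟧-× (Y? a) (box? m C x))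

    box?-inside : ∀ (C : Subset n) a x → ⟦ box? 0 (true ∷ C) (a ∷ x) ⟧ ≡ 1ℤ ℤ.* ⟦ box? 0 C x ⟧
    box?-inside C a x = trans
      (⟦⟧-cong
        (λ b i → (λ ()) , λ _ i∉C → proj₂ (b (suc i)) z≤n (i∉C ∘ drop-there))
        (λ { b zero → (λ ()) , λ _ 0∉C → contradiction here 0∉C
           ; b (suc i) → (λ ()) , λ _ i∉C → proj₂ (b i) z≤n (i∉C ∘ there) })
        (box? 0 (true ∷ C) (a ∷ x)) (box? 0 C x))
      (sym (ℤ.*-identityˡ ⟦ box? 0 C x ⟧))

    box?-outside : ∀ (C : Subset n) a x → ⟦ box? 0 (false ∷ C) (a ∷ x) ⟧ ≡ ⟦ a Fin.≟ 0ᶠ ⟧ ℤ.* ⟦ box? 0 C x ⟧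
    box?-outside C a x = trans
      (⟦⟧-cong
        (λ b → proj₂ (b zero) z≤n (λ ()) , λ i → (λ ()) , λ _ i∉C → proj₂ (b (suc i)) z≤n (i∉C ∘ drop-there))
        (λ { (a≡0 , b) zero → (λ ()) , λ _ _ → a≡0
           ; (a≡0 , b) (suc i) → (λ ()) , λ _ i∉C → proj₂ (b i) z≤n (i∉C ∘ there) })
        (box? 0 (false ∷ C) (a ∷ x)) (a Fin.≟ 0ᶠ ×-dec box? 0 C x))
      (⟦⟧-× (a Fin.≟ 0ᶠ) (box? 0 C x))

  vanishesOn?-inside : ∀ (C : Subset n) w u →
    ⟦ vanishesOn? (true ∷ C) (w ∷ u) ⟧ ≡ ⟦ w Fin.≟ 0ᶠ ⟧ ℤ.* ⟦ vanishesOn? C u ⟧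
  vanishesOn?-inside C w u = trans
    (⟦⟧-cong
      (λ van → van zero here , λ j j∈C → van (suc j) (there j∈C))
      (λ { (w≡0 , van) zero _ → w≡0 ; (w≡0 , van) (suc j) (there j∈C) → van j j∈C })
      (vanishesOn? (true ∷ C) (w ∷ u)) (w Fin.≟ 0ᶠ ×-dec vanishesOn? C u))
    (⟦⟧-× (w Fin.≟ 0ᶠ) (vanishesOn? C u))

  vanishesOn?-outside : ∀ (C : Subset n) w u → ⟦ vanishesOn? (false ∷ C) (w ∷ u) ⟧ ≡ ⟦ vanishesOn? C u ⟧
  vanishesOn?-outside C w u =
    ⟦⟧-cong
      (λ van j j∈C → van (suc j) (there j∈C))
      (λ { van (suc j) (there j∈C) → van j j∈C })
      (vanishesOn? (false ∷ C) (w ∷ u)) (vanishesOn? C u)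

  -- Fubini for a weight E that splits off a factor in the first coordinate:
  -- that coordinate only moves the base point c of the remaining sum.
  sumᵛ-peel : ∀ (E : Vec (𝔽 p) (suc n) → ℤ) (ω : 𝔽 p → ℤ) (F : Vec (𝔽 p) n → ℤ) (g : 𝔽 p → ℤ) c w u →
    (∀ a x → E (a ∷ x) ≡ ω a ℤ.* F x) →
    sumᵛ (λ x → E x ℤ.* g (c +ᶠ (w ∷ u) · x)) ≡
    sum (λ a → ω a ℤ.* sumᵛ (λ x → F x ℤ.* g ((c +ᶠ w *ᶠ a) +ᶠ u · x)))
  sumᵛ-peel E ω F g c w u E≡ωF = sum-cong-≗ λ a → trans
    (sumᵛ-cong λ x → trans
      (cong₂ (λ e y → e ℤ.* g y) (E≡ωF a x) (sym (+ᶠ-assoc c (w *ᶠ a) (u · x))))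
      (ℤ.*-assoc (ω a) (F x) _))
    (sym (*-distribˡ-sumᵛ (ω a) (λ x → F x ℤ.* g ((c +ᶠ w *ᶠ a) +ᶠ u · x))))

  -- The factor by which summing h (c +ᶠ v · y) over all y without zero
  -- coordinates multiplies h c, for h with total sum zero.
  nonzero-eigenvalue : Vec (𝔽 p) m → ℤ
  nonzero-eigenvalue {m} v = -1ℤ ℤ.^ wt v ℤ.* (+ (p ∸ 1)) ℤ.^ (m ∸ wt v)

  nonzero-eigenvalue-∷ : ∀ w (v : Vec (𝔽 p) m) →
    (+ p ℤ.* ⟦ w Fin.≟ 0ᶠ ⟧ ℤ.+ -1ℤ) ℤ.* nonzero-eigenvalue v ≡ nonzero-eigenvalue (w ∷ v)
  nonzero-eigenvalue-∷ {m} w v with w Fin.≟ 0ᶠ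
  ... | yes _ = begin
    (+ p ℤ.* 1ℤ ℤ.+ -1ℤ) ℤ.* (S ℤ.* R)
      ≡⟨ cong (λ q → (+ q ℤ.* 1ℤ ℤ.+ -1ℤ) ℤ.* (S ℤ.* R)) (ℕ.suc-pred p) ⟨
    (+ suc (p ∸ 1) ℤ.* 1ℤ ℤ.+ -1ℤ) ℤ.* (S ℤ.* R)
      ≡⟨ cong (λ z → (z ℤ.* 1ℤ ℤ.+ -1ℤ) ℤ.* (S ℤ.* R)) (ℤ.pos-+ 1 (p ∸ 1)) ⟩
    ((1ℤ ℤ.+ + (p ∸ 1)) ℤ.* 1ℤ ℤ.+ -1ℤ) ℤ.* (S ℤ.* R)
      ≡⟨ regroup (+ (p ∸ 1)) S R ⟩
    S ℤ.* (+ (p ∸ 1) ℤ.* R)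
      ≡⟨ cong (λ e → S ℤ.* (+ (p ∸ 1)) ℤ.^ e) (ℕ.+-∸-assoc 1 (Vec.count≤n _ v)) ⟨
    S ℤ.* (+ (p ∸ 1)) ℤ.^ (suc m ∸ wt v) ∎
    where
    open ≡-Reasoning
    S = -1ℤ ℤ.^ wt v
    R = (+ (p ∸ 1)) ℤ.^ (m ∸ wt v)
    regroup : ∀ q s r → ((1ℤ ℤ.+ q) ℤ.* 1ℤ ℤ.+ -1ℤ) ℤ.* (s ℤ.* r) ≡ s ℤ.* (q ℤ.* r)
    regroup = solve-∀
  ... | no _ = trans
    (cong (λ z → (z ℤ.+ -1ℤ) ℤ.* nonzero-eigenvalue v) (ℤ.*-zeroʳ (+ p)))
    (sym (ℤ.*-assoc -1ℤ (-1ℤ ℤ.^ wt v) ((+ (p ∸ 1)) ℤ.^ (m ∸ wt v))))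

  -- Sums over boxes

  module _ (pr : Prime p) (h : 𝔽 p → ℤ) (Σh≡0 : sum h ≡ 0ℤ) where

    -- Every h of total sum zero is an eigenfunction of summation along the
    -- multiples of w.
    sum-affine-zeroSum : ∀ c w → sum (λ a → h (c +ᶠ w *ᶠ a)) ≡ + p ℤ.* ⟦ w Fin.≟ 0ᶠ ⟧ ℤ.* h c
    sum-affine-zeroSum c w with w Fin.≟ 0ᶠ
    ... | yes refl = begin
      sum (λ a → h (c +ᶠ 0ᶠ *ᶠ a)) ≡⟨ sum-cong-≗ (λ a → cong h (+0ᶠ* c a)) ⟩
      sum {p} (λ _ → h c)          ≡⟨ sum-const p (h c) ⟩
      + p ℤ.* h c                  ≡⟨ cong (ℤ._* h c) (ℤ.*-identityʳ (+ p)) ⟨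
      + p ℤ.* 1ℤ ℤ.* h c           ∎
      where open ≡-Reasoning
    ... | no w≢0 = begin
      sum (λ a → h (c +ᶠ w *ᶠ a)) ≡⟨ sum-affine pr c w h w≢0 ⟩
      sum h                       ≡⟨ Σh≡0 ⟩
      0ℤ                          ≡⟨ cong (ℤ._* h c) (ℤ.*-zeroʳ (+ p)) ⟨
      + p ℤ.* 0ℤ ℤ.* h c          ∎
      where open ≡-Reasoning

    sum-affine-scaled : ∀ k z c w →
      sum (λ a → + k ℤ.* z ℤ.* h (c +ᶠ w *ᶠ a)) ≡ + (p * k) ℤ.* (⟦ w Fin.≟ 0ᶠ ⟧ ℤ.* z) ℤ.* h c
    sum-affine-scaled k z c w = begin
      sum (λ a → + k ℤ.* z ℤ.* h (c +ᶠ w *ᶠ a))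
        ≡⟨ *-distribˡ-sum (+ k ℤ.* z) (λ a → h (c +ᶠ w *ᶠ a)) ⟨
      + k ℤ.* z ℤ.* sum (λ a → h (c +ᶠ w *ᶠ a))
        ≡⟨ cong (+ k ℤ.* z ℤ.*_) (sum-affine-zeroSum c w) ⟩
      + k ℤ.* z ℤ.* (+ p ℤ.* ⟦ w Fin.≟ 0ᶠ ⟧ ℤ.* h c)
        ≡⟨ regroup (+ k) z (+ p) ⟦ w Fin.≟ 0ᶠ ⟧ (h c) ⟩
      + p ℤ.* + k ℤ.* (⟦ w Fin.≟ 0ᶠ ⟧ ℤ.* z) ℤ.* h c
        ≡⟨ cong (λ q → q ℤ.* (⟦ w Fin.≟ 0ᶠ ⟧ ℤ.* z) ℤ.* h c) (ℤ.pos-* p k) ⟨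
      + (p * k) ℤ.* (⟦ w Fin.≟ 0ᶠ ⟧ ℤ.* z) ℤ.* h c ∎
      where
      open ≡-Reasoning
      regroup : ∀ k z q i y → k ℤ.* z ℤ.* (q ℤ.* i ℤ.* y) ≡ q ℤ.* k ℤ.* (i ℤ.* z) ℤ.* y
      regroup = solve-∀

    module _ {Y : Pred (𝔽 p) 0ℓ} (Y? : Decidable Y) where

      -- A family playing the role of the sum of h (c +ᶠ v · y) over all y in Y ^ m,
      -- as characterised by its recursion in m.
      record PrefixSums : Set where
        field
          prefixSum    : Vec (𝔽 p) m → 𝔽 p → ℤ
          prefixSum-[] : ∀ c → prefixSum [] c ≡ h c
          prefixSum-∷  : ∀ w (v : Vec (𝔽 p) m) c →
            sum (λ a → ⟦ Y? a ⟧ ℤ.* prefixSum v (c +ᶠ w *ᶠ a)) ≡ prefixSum (w ∷ v) c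

      -- The case m = 0: coordinates outside C are zero and those in C are free.
      sumᵛ-box-suffix : ∀ (C : Subset n) u c →
        sumᵛ (λ x → ⟦ box? Y? 0 C x ⟧ ℤ.* h (c +ᶠ u · x)) ≡
        + (p ^ ∣ C ∣) ℤ.* ⟦ vanishesOn? C u ⟧ ℤ.* h c
      sumᵛ-box-suffix [] [] c = cong (λ y → 1ℤ ℤ.* h y) (+ᶠ-identityʳ c)
      sumᵛ-box-suffix (false ∷ C) (w ∷ u) c = begin
        sumᵛ (λ x → ⟦ box? Y? 0 (false ∷ C) x ⟧ ℤ.* h (c +ᶠ (w ∷ u) · x))
          ≡⟨ sumᵛ-peel (λ x → ⟦ box? Y? 0 (false ∷ C) x ⟧) (λ a → ⟦ a Fin.≟ 0ᶠ ⟧) (λ x → ⟦ box? Y? 0 C x ⟧)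
               h c w u (box?-outside Y? C) ⟩
        sum (λ a → ⟦ a Fin.≟ 0ᶠ ⟧ ℤ.* sumᵛ (λ x → ⟦ box? Y? 0 C x ⟧ ℤ.* h ((c +ᶠ w *ᶠ a) +ᶠ u · x)))
          ≡⟨ sum-point (λ a → sumᵛ (λ x → ⟦ box? Y? 0 C x ⟧ ℤ.* h ((c +ᶠ w *ᶠ a) +ᶠ u · x))) 0ᶠ ⟩
        sumᵛ (λ x → ⟦ box? Y? 0 C x ⟧ ℤ.* h ((c +ᶠ w *ᶠ 0ᶠ) +ᶠ u · x))
          ≡⟨ sumᵛ-box-suffix C u (c +ᶠ w *ᶠ 0ᶠ) ⟩
        + (p ^ ∣ C ∣) ℤ.* ⟦ vanishesOn? C u ⟧ ℤ.* h (c +ᶠ w *ᶠ 0ᶠ)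
          ≡⟨ cong₂ (λ d y → + (p ^ ∣ C ∣) ℤ.* d ℤ.* h y) (sym (vanishesOn?-outside C w u))
               (trans (cong (c +ᶠ_) (*ᶠ-zeroʳ w)) (+ᶠ-identityʳ c)) ⟩
        + (p ^ ∣ C ∣) ℤ.* ⟦ vanishesOn? (false ∷ C) (w ∷ u) ⟧ ℤ.* h c ∎
        where open ≡-Reasoning
      sumᵛ-box-suffix (true ∷ C) (w ∷ u) c = begin
        sumᵛ (λ x → ⟦ box? Y? 0 (true ∷ C) x ⟧ ℤ.* h (c +ᶠ (w ∷ u) · x))
          ≡⟨ sumᵛ-peel (λ x → ⟦ box? Y? 0 (true ∷ C) x ⟧) (λ _ → 1ℤ) (λ x → ⟦ box? Y? 0 C x ⟧)
               h c w u (box?-inside Y? C) ⟩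
        sum (λ a → 1ℤ ℤ.* sumᵛ (λ x → ⟦ box? Y? 0 C x ⟧ ℤ.* h ((c +ᶠ w *ᶠ a) +ᶠ u · x)))
          ≡⟨ sum-cong-≗ (λ a → trans (ℤ.*-identityˡ _) (sumᵛ-box-suffix C u (c +ᶠ w *ᶠ a))) ⟩
        sum (λ a → + (p ^ ∣ C ∣) ℤ.* ⟦ vanishesOn? C u ⟧ ℤ.* h (c +ᶠ w *ᶠ a))
          ≡⟨ sum-affine-scaled (p ^ ∣ C ∣) ⟦ vanishesOn? C u ⟧ c w ⟩
        + (p ^ suc ∣ C ∣) ℤ.* (⟦ w Fin.≟ 0ᶠ ⟧ ℤ.* ⟦ vanishesOn? C u ⟧) ℤ.* h c
          ≡⟨ cong (λ d → + (p ^ suc ∣ C ∣) ℤ.* d ℤ.* h c) (vanishesOn?-inside C w u) ⟨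
        + (p ^ suc ∣ C ∣) ℤ.* ⟦ vanishesOn? (true ∷ C) (w ∷ u) ⟧ ℤ.* h c ∎
        where open ≡-Reasoning

      module _ (sums : PrefixSums) where
        open PrefixSums sums

        -- The suffix contributes a scalar factor and the prefix its own sum.
        sumᵛ-box : (m≤n : m ≤ n) (C : Subset n) → (∀ j → j ∈ C → m ≤ toℕ j) → ∀ u c →
          sumᵛ (λ x → ⟦ box? Y? m C x ⟧ ℤ.* h (c +ᶠ u · x)) ≡
          + (p ^ ∣ C ∣) ℤ.* ⟦ vanishesOn? C u ⟧ ℤ.* prefixSum (truncate m≤n u) c
        sumᵛ-box {zero} z≤n C _ u c = trans (sumᵛ-box-suffix C u c)
          (cong (+ (p ^ ∣ C ∣) ℤ.* ⟦ vanishesOn? C u ⟧ ℤ.*_) (sym (prefixSum-[] c)))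
        sumᵛ-box {suc m} (s≤s m≤n) (true  ∷ C) C≥m (w ∷ u) c = contradiction (C≥m zero here) λ ()
        sumᵛ-box {suc m} (s≤s m≤n) (false ∷ C) C≥m (w ∷ u) c = begin
          sumᵛ (λ x → ⟦ box? Y? (suc m) (false ∷ C) x ⟧ ℤ.* h (c +ᶠ (w ∷ u) · x))
            ≡⟨ sumᵛ-peel (λ x → ⟦ box? Y? (suc m) (false ∷ C) x ⟧) (λ a → ⟦ Y? a ⟧) (λ x → ⟦ box? Y? m C x ⟧)
                 h c w u (box?-prefix Y? m C) ⟩
          sum (λ a → ⟦ Y? a ⟧ ℤ.* sumᵛ (λ x → ⟦ box? Y? m C x ⟧ ℤ.* h ((c +ᶠ w *ᶠ a) +ᶠ u · x)))
            ≡⟨ sum-cong-≗ (λ a → trans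
                 (cong (⟦ Y? a ⟧ ℤ.*_)
                   (sumᵛ-box m≤n C (λ j j∈C → ℕ.≤-pred (C≥m (suc j) (there j∈C))) u (c +ᶠ w *ᶠ a)))
                 (commute ⟦ Y? a ⟧ K _)) ⟩
          sum (λ a → K ℤ.* (⟦ Y? a ⟧ ℤ.* prefixSum v (c +ᶠ w *ᶠ a)))
            ≡⟨ *-distribˡ-sum K (λ a → ⟦ Y? a ⟧ ℤ.* prefixSum v (c +ᶠ w *ᶠ a)) ⟨
          K ℤ.* sum (λ a → ⟦ Y? a ⟧ ℤ.* prefixSum v (c +ᶠ w *ᶠ a))
            ≡⟨ cong (K ℤ.*_) (prefixSum-∷ w v c) ⟩
          K ℤ.* prefixSum (w ∷ v) c
            ≡⟨ cong (λ d → + (p ^ ∣ C ∣) ℤ.* d ℤ.* prefixSum (w ∷ v) c) (vanishesOn?-outside C w u) ⟨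
          + (p ^ ∣ C ∣) ℤ.* ⟦ vanishesOn? (false ∷ C) (w ∷ u) ⟧ ℤ.* prefixSum (w ∷ v) c ∎
          where
          open ≡-Reasoning
          v = truncate m≤n u
          K = + (p ^ ∣ C ∣) ℤ.* ⟦ vanishesOn? C u ⟧
          commute : ∀ y k t → y ℤ.* (k ℤ.* t) ≡ k ℤ.* (y ℤ.* t)
          commute = solve-∀

    full-prefixSums : PrefixSums full?
    full-prefixSums = record
      { prefixSum    = λ {m} v c → + (p ^ m) ℤ.* ⟦ v ≟⃗ 0⃗ ⟧ ℤ.* h c
      ; prefixSum-[] = λ c → ℤ.*-identityˡ (h c)
      ; prefixSum-∷  = λ {m} w v c → begin
          sum (λ a → 1ℤ ℤ.* (+ (p ^ m) ℤ.* ⟦ v ≟⃗ 0⃗ ⟧ ℤ.* h (c +ᶠ w *ᶠ a)))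
            ≡⟨ sum-cong-≗ (λ a → ℤ.*-identityˡ (+ (p ^ m) ℤ.* ⟦ v ≟⃗ 0⃗ ⟧ ℤ.* h (c +ᶠ w *ᶠ a))) ⟩
          sum (λ a → + (p ^ m) ℤ.* ⟦ v ≟⃗ 0⃗ ⟧ ℤ.* h (c +ᶠ w *ᶠ a))
            ≡⟨ sum-affine-scaled (p ^ m) ⟦ v ≟⃗ 0⃗ ⟧ c w ⟩
          + (p ^ suc m) ℤ.* (⟦ w Fin.≟ 0ᶠ ⟧ ℤ.* ⟦ v ≟⃗ 0⃗ ⟧) ℤ.* h c
            ≡⟨ cong (λ d → + (p ^ suc m) ℤ.* d ℤ.* h c) (⟦⟧-× (w Fin.≟ 0ᶠ) (v ≟⃗ 0⃗)) ⟨
          + (p ^ suc m) ℤ.* ⟦ (w ∷ v) ≟⃗ 0⃗ ⟧ ℤ.* h c ∎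
      }
      where open ≡-Reasoning

    nonzero-prefixSums : PrefixSums (λ a → ¬? (a Fin.≟ 0ᶠ))
    nonzero-prefixSums = record
      { prefixSum    = λ v c → nonzero-eigenvalue v ℤ.* h c
      ; prefixSum-[] = λ c → ℤ.*-identityˡ (h c)
      ; prefixSum-∷  = λ w v c → let K = nonzero-eigenvalue v; g = λ a → h (c +ᶠ w *ᶠ a) in begin
          sum (λ a → ⟦ ¬? (a Fin.≟ 0ᶠ) ⟧ ℤ.* (K ℤ.* g a))
            ≡⟨ sum-cong-≗ (λ a → trans
                 (cong (ℤ._* (K ℤ.* g a)) (⟦⟧-¬ (a Fin.≟ 0ᶠ)))
                 (expand ⟦ a Fin.≟ 0ᶠ ⟧ K (g a))) ⟩
          sum (λ a → K ℤ.* g a ℤ.+ ⟦ a Fin.≟ 0ᶠ ⟧ ℤ.* (-1ℤ ℤ.* K ℤ.* g a))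
            ≡⟨ ∑-distrib-+ (λ a → K ℤ.* g a) (λ a → ⟦ a Fin.≟ 0ᶠ ⟧ ℤ.* (-1ℤ ℤ.* K ℤ.* g a)) ⟩
          sum (λ a → K ℤ.* g a) ℤ.+ sum (λ a → ⟦ a Fin.≟ 0ᶠ ⟧ ℤ.* (-1ℤ ℤ.* K ℤ.* g a))
            ≡⟨ cong₂ ℤ._+_ (sym (*-distribˡ-sum K g)) (sum-point (λ a → -1ℤ ℤ.* K ℤ.* g a) 0ᶠ) ⟩
          K ℤ.* sum g ℤ.+ -1ℤ ℤ.* K ℤ.* g 0ᶠ
            ≡⟨ cong₂ (λ y z → K ℤ.* y ℤ.+ -1ℤ ℤ.* K ℤ.* h z) (sum-affine-zeroSum c w)
                 (trans (cong (c +ᶠ_) (*ᶠ-zeroʳ w)) (+ᶠ-identityʳ c)) ⟩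
          K ℤ.* (+ p ℤ.* ⟦ w Fin.≟ 0ᶠ ⟧ ℤ.* h c) ℤ.+ -1ℤ ℤ.* K ℤ.* h c
            ≡⟨ collect (+ p ℤ.* ⟦ w Fin.≟ 0ᶠ ⟧) K (h c) ⟩
          (+ p ℤ.* ⟦ w Fin.≟ 0ᶠ ⟧ ℤ.+ -1ℤ) ℤ.* K ℤ.* h c
            ≡⟨ cong (ℤ._* h c) (nonzero-eigenvalue-∷ w v) ⟩
          nonzero-eigenvalue (w ∷ v) ℤ.* h c ∎
      }
      where
      open ≡-Reasoning
      expand : ∀ i k z → (1ℤ ℤ.+ -1ℤ ℤ.* i) ℤ.* (k ℤ.* z) ≡ k ℤ.* z ℤ.+ i ℤ.* (-1ℤ ℤ.* k ℤ.* z)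
      expand = solve-∀
      collect : ∀ x k z → k ℤ.* (x ℤ.* z) ℤ.+ -1ℤ ℤ.* k ℤ.* z ≡ (x ℤ.+ -1ℤ) ℤ.* k ℤ.* z
      collect = solve-∀

    singleton-prefixSums : ∀ b → PrefixSums (λ a → a Fin.≟ b)
    singleton-prefixSums b = record
      { prefixSum    = λ {m} v c → h (c +ᶠ v · Vec.replicate m b)
      ; prefixSum-[] = λ c → cong h (+ᶠ-identityʳ c)
      ; prefixSum-∷  = λ {m} w v c → trans
          (sum-point (λ a → h ((c +ᶠ w *ᶠ a) +ᶠ v · Vec.replicate m b)) b)
          (cong h (+ᶠ-assoc c (w *ᶠ b) _))
      }

module _ {p : ℕ} .{{_ : NonZero p}} where

  -- Ideals contained in fullIdeal as a union of boxes

  ∈support⇒≢0 : ∀ (x : Vec (𝔽 p) n) {i} → i ∈ support x → lookup x i ≢ 0ᶠ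
  ∈support⇒≢0 x {i} i∈ x≡0 = contradiction
    (trans (sym (Vec.[]=⇒lookup i∈)) (trans (Vec.lookup-map i _ x)
      (dec-false (¬? (lookup x i Fin.≟ 0ᶠ)) (λ x≢0 → x≢0 x≡0))))
    λ ()

  ≢0⇒∈support : ∀ (x : Vec (𝔽 p) n) {i} → lookup x i ≢ 0ᶠ → i ∈ support x
  ≢0⇒∈support x {i} x≢0 = Vec.lookup⇒[]= i (support x)
    (trans (Vec.lookup-map i _ x) (dec-true (¬? (lookup x i Fin.≟ 0ᶠ)) x≢0))

  toℕ--1ᶠ : toℕ (-1ᶠ {p}) ≡ p ∸ 1
  toℕ--1ᶠ = trans (toℕ-mod (p ∸ 1)) (m<n⇒m%n≡m (ℕ.≤-reflexive (ℕ.suc-pred p)))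

  ≤-1ᶠ : (a : 𝔽 p) → a Fin.≤ -1ᶠ {p}
  ≤-1ᶠ a = subst (toℕ a ≤_) (sym toℕ--1ᶠ) (ℕ.<⇒≤pred (Fin.toℕ<n a))

  0ᶠ≤ : (a : 𝔽 p) → 0ᶠ {p} Fin.≤ a
  0ᶠ≤ a = subst (_≤ toℕ a) (sym toℕ-0ᶠ) z≤n

  ≤0ᶠ⇒≡0 : {a : 𝔽 p} → a Fin.≤ 0ᶠ {p} → a ≡ 0ᶠ
  ≤0ᶠ⇒≡0 {a} a≤0 = Fin.toℕ-injective (ℕ.≤-antisym a≤0 (0ᶠ≤ a))

  lookup-fullIdeal : ∀ m (B : Subset n) i →
    lookup (fullIdeal {p} m B) i ≡ (if does (toℕ i ℕ.<? m ⊎-dec i ∈? B) then -1ᶠ else 0ᶠ)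
  lookup-fullIdeal m B i = Vec.lookup∘tabulate _ i

  fullIdeal-inside : ∀ m (B : Subset n) i → toℕ i < m ⊎ i ∈ B → lookup (fullIdeal {p} m B) i ≡ -1ᶠ
  fullIdeal-inside m B i i∈ = trans (lookup-fullIdeal m B i)
    (cong (if_then -1ᶠ else 0ᶠ) (dec-true (toℕ i ℕ.<? m ⊎-dec i ∈? B) i∈))

  fullIdeal-outside : ∀ m (B : Subset n) i → ¬ (toℕ i < m ⊎ i ∈ B) → lookup (fullIdeal {p} m B) i ≡ 0ᶠ
  fullIdeal-outside m B i i∉ = trans (lookup-fullIdeal m B i)
    (cong (if_then -1ᶠ else 0ᶠ) (dec-false (toℕ i ℕ.<? m ⊎-dec i ∈? B) i∉))

  -- The values allowed in the coordinates of [m] once some coordinate outside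
  -- [m] is nonzero.
  Below : IdealType → Pred (𝔽 p) 0ℓ
  Below unsaturated a = a ≢ 0ᶠ
  Below saturated   a = a ≡ -1ᶠ

  below? : ∀ τ → Decidable (Below τ)
  below? unsaturated a = ¬? (a Fin.≟ 0ᶠ)
  below? saturated   a = a Fin.≟ -1ᶠ

  -1≢0 : Prime p → -1ᶠ {p} ≢ 0ᶠ
  -1≢0 pr -1≡0 = ℕ.<⇒≱ (ℕ.nonTrivial⇒n>1 p {{prime⇒nonTrivial pr}})
    (ℕ.m∸n≡0⇒m≤n (trans (sym toℕ--1ᶠ) (trans (cong toℕ -1≡0) toℕ-0ᶠ)))

  Below⇒≢0 : Prime p → ∀ τ {a} → Below τ a → a ≢ 0ᶠ
  Below⇒≢0 pr unsaturated a≢0 = a≢0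
  Below⇒≢0 pr saturated   a≡-1 a≡0 = -1≢0 pr (trans (sym a≡-1) a≡0)

  orderIdeal-intro : ∀ m (x : Vec (𝔽 p) n) →
    (∀ i j → lookup x j ≢ 0ᶠ → i ≺[ m ] j → lookup x i ≢ 0ᶠ) → IsOrderIdeal m (support x)
  orderIdeal-intro m x below i j j∈ (inj₁ i≺j)  = ≢0⇒∈support x (below i j (∈support⇒≢0 x j∈) i≺j)
  orderIdeal-intro m x below i j j∈ (inj₂ refl) = j∈

  -- Both kinds of ideals are described by one condition: a nonzero coordinate
  -- forces the coordinates below it to take values in Below τ.
  isIdeal-intro : Prime p → ∀ τ m (x : Vec (𝔽 p) n) →
    (∀ i j → lookup x j ≢ 0ᶠ → i ≺[ m ] j → Below τ (lookup x i)) → IsIdeal τ m x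
  isIdeal-intro pr unsaturated m x below = orderIdeal-intro m x below
  isIdeal-intro pr saturated   m x below =
    orderIdeal-intro m x (λ i j xj≢0 i≺j → Below⇒≢0 pr saturated (below i j xj≢0 i≺j)) ,
    λ i j j∈ i≺j → trans (cong toℕ (below i j (∈support⇒≢0 x j∈) i≺j)) toℕ--1ᶠ

  isIdeal-elim : ∀ τ m (x : Vec (𝔽 p) n) → IsIdeal τ m x →
    ∀ i j → lookup x j ≢ 0ᶠ → i ≺[ m ] j → Below τ (lookup x i)
  isIdeal-elim unsaturated m x ideal i j xj≢0 i≺j =
    ∈support⇒≢0 x (ideal i j (≢0⇒∈support x xj≢0) (inj₁ i≺j))
  isIdeal-elim saturated m x (_ , sat) i j xj≢0 i≺j =
    Fin.toℕ-injective (trans (sat i j (≢0⇒∈support x xj≢0) i≺j) (sym toℕ--1ᶠ))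

  Box-full : ∀ m (C : Subset n) x → (∀ i → m ≤ toℕ i → i ∉ C → lookup x i ≡ 0ᶠ) → Box Full m C x
  Box-full m C x zero-outside i = (λ _ → tt) , zero-outside i

  Box⇒⊑ : ∀ m (B : Subset n) x → Box Full m B x → x ⊑ fullIdeal m B
  Box⇒⊑ m B x box i with toℕ i ℕ.<? m | i ∈? B
  ... | yes i<m | _       = subst (lookup x i Fin.≤_) (sym (fullIdeal-inside m B i (inj₁ i<m))) (≤-1ᶠ _)
  ... | no  _   | yes i∈B = subst (lookup x i Fin.≤_) (sym (fullIdeal-inside m B i (inj₂ i∈B))) (≤-1ᶠ _)
  ... | no  i≮m | no  i∉B =
    subst (Fin._≤ lookup (fullIdeal m B) i) (sym (proj₂ (box i) (ℕ.≮⇒≥ i≮m) i∉B)) (0ᶠ≤ _)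

  ⊑⇒zero : ∀ m (B : Subset n) x → x ⊑ fullIdeal m B → ∀ i → m ≤ toℕ i → i ∉ B → lookup x i ≡ 0ᶠ
  ⊑⇒zero m B x x⊑I i m≤i i∉B = ≤0ᶠ⇒≡0 (subst (lookup x i Fin.≤_)
    (fullIdeal-outside m B i [ (λ i<m → contradiction m≤i (ℕ.<⇒≱ i<m)) , i∉B ]′) (x⊑I i))

  -- The alternatives are whether the coordinates outside [m] all vanish.
  SubIdeal⇒Boxes : ∀ τ m (B : Subset n) x → SubIdeal τ m (fullIdeal m B) x →
    Box Full m ⊥ x ⊎ Box (Below τ) m B x
  SubIdeal⇒Boxes τ m B x (ideal , x⊑I) with Fin.any? (λ j → m ℕ.≤? toℕ j ×-dec ¬? (lookup x j Fin.≟ 0ᶠ))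
  ... | yes (j , m≤j , xj≢0) = inj₂ λ i →
    (λ i<m → isIdeal-elim τ m x ideal i j xj≢0 (i<m , m≤j)) , ⊑⇒zero m B x x⊑I i
  ... | no none = inj₁ (Box-full m ⊥ x λ i m≤i _ →
    decidable-stable (lookup x i Fin.≟ 0ᶠ) λ xi≢0 → none (i , m≤i , xi≢0))

  Boxes⇒SubIdeal : Prime p → ∀ τ m (B : Subset n) x →
    Box Full m ⊥ x ⊎ Box (Below τ) m B x → SubIdeal τ m (fullIdeal m B) x
  Boxes⇒SubIdeal pr τ m B x (inj₁ box) =
    isIdeal-intro pr τ m x (λ i j xj≢0 (_ , m≤j) → contradiction (proj₂ (box j) m≤j ∉⊥) xj≢0) ,
    Box⇒⊑ m B x (Box-full m B x λ i m≤i _ → proj₂ (box i) m≤i ∉⊥)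
  Boxes⇒SubIdeal pr τ m B x (inj₂ box) =
    isIdeal-intro pr τ m x (λ i j _ (i<m , _) → proj₁ (box i) i<m) ,
    Box⇒⊑ m B x (Box-full m B x λ i → proj₂ (box i))

  ⟦subIdeal?⟧ : Prime p → ∀ τ m (B : Subset n) x →
    ⟦ subIdeal? τ m (fullIdeal m B) x ⟧ ≡
    ⟦ box? full? m ⊥ x ⟧ ℤ.+ ⟦ box? (below? τ) m B x ⟧ ℤ.+ -1ℤ ℤ.* ⟦ box? (below? τ) m ⊥ x ⟧
  ⟦subIdeal?⟧ pr τ m B x = ⟦⟧-inclusion-exclusion
    (SubIdeal⇒Boxes τ m B x) (Boxes⇒SubIdeal pr τ m B x)
    (λ box → Box-full m ⊥ x (λ i → proj₂ (box i)) , λ i → proj₁ (box i) , λ m≤i _ → proj₂ (box i) m≤i ∉⊥)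
    (λ (boxA , boxB) i → proj₁ (boxB i) , proj₂ (boxA i))
    (subIdeal? τ m (fullIdeal m B) x) (box? full? m ⊥ x) (box? (below? τ) m B x) (box? (below? τ) m ⊥ x)

  0⃗∈ideal : Prime p → ∀ τ m (B : Subset n) → SubIdeal τ m (fullIdeal {p} m B) 0⃗
  0⃗∈ideal pr τ m B = Boxes⇒SubIdeal pr τ m B 0⃗
    (inj₁ (Box-full m ⊥ 0⃗ λ i _ _ → Vec.lookup-replicate i 0ᶠ))

  -- The weight as a sum over the ideal

  -- The function h = [a = 0] - [s + a = 0]: by how much the indicator of being
  -- nonzero grows when a is replaced by s + a.
  shiftDifference : 𝔽 p → 𝔽 p → ℤ
  shiftDifference s a = ⟦ a Fin.≟ 0ᶠ ⟧ ℤ.+ -1ℤ ℤ.* ⟦ s +ᶠ a Fin.≟ 0ᶠ ⟧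

  sum-shiftDifference : ∀ s → sum (shiftDifference s) ≡ 0ℤ
  sum-shiftDifference s = begin
    sum (λ a → ⟦ a Fin.≟ 0ᶠ ⟧ ℤ.+ -1ℤ ℤ.* ⟦ s +ᶠ a Fin.≟ 0ᶠ ⟧)
      ≡⟨ ∑-distrib-+ (λ a → ⟦ a Fin.≟ 0ᶠ ⟧) (λ a → -1ℤ ℤ.* ⟦ s +ᶠ a Fin.≟ 0ᶠ ⟧) ⟩
    sum (λ a → ⟦ a Fin.≟ 0ᶠ {p} ⟧) ℤ.+ sum (λ a → -1ℤ ℤ.* ⟦ s +ᶠ a Fin.≟ 0ᶠ ⟧)
      ≡⟨ cong₂ ℤ._+_ (sum-indicator 0ᶠ) (sym (*-distribˡ-sum -1ℤ (λ a → ⟦ s +ᶠ a Fin.≟ 0ᶠ ⟧))) ⟩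
    1ℤ ℤ.+ -1ℤ ℤ.* sum (λ a → ⟦ s +ᶠ a Fin.≟ 0ᶠ ⟧)
      ≡⟨ cong (λ z → 1ℤ ℤ.+ -1ℤ ℤ.* z) (trans
           (sum-cong-≗ λ a → ⟦⟧-cong (to a) (from a) (s +ᶠ a Fin.≟ 0ᶠ) (a Fin.≟ s *ᶠ -1ᶠ))
           (sum-indicator (s *ᶠ -1ᶠ))) ⟩
    0ℤ ∎
    where
    open ≡-Reasoning
    from : ∀ a → a ≡ s *ᶠ -1ᶠ → s +ᶠ a ≡ 0ᶠ
    from a refl = a+a*-1≡0 s
    to : ∀ a → s +ᶠ a ≡ 0ᶠ → a ≡ s *ᶠ -1ᶠ
    to a s+a≡0 = +ᶠ-cancelʳ a (s *ᶠ -1ᶠ) s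
      (trans (+ᶠ-comm a s) (trans s+a≡0 (sym (trans (+ᶠ-comm _ s) (a+a*-1≡0 s)))))

  shiftDifference-0 : ∀ {s} → s ≢ 0ᶠ → shiftDifference s 0ᶠ ≡ 1ℤ
  shiftDifference-0 {s} s≢0
    rewrite ⟦⟧-true refl (0ᶠ {p} Fin.≟ 0ᶠ)
          | ⟦⟧-false (s≢0 ∘ trans (sym (+ᶠ-identityʳ s))) (s +ᶠ 0ᶠ Fin.≟ 0ᶠ) = refl

  shiftDifference-zero : ∀ a → shiftDifference 0ᶠ a ≡ 0ℤ
  shiftDifference-zero a rewrite +ᶠ-identityˡ a = cancel ⟦ a Fin.≟ 0ᶠ ⟧
    where
    cancel : ∀ i → i ℤ.+ -1ℤ ℤ.* i ≡ 0ℤ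
    cancel = solve-∀

  shiftDifference-neg : ∀ s {a b} → a +ᶠ b ≡ 0ᶠ → shiftDifference s b ≡ ⟦ a Fin.≟ 0ᶠ ⟧ ℤ.- ⟦ a Fin.≟ s ⟧
  shiftDifference-neg s {a} {b} a+b≡0 = begin
    ⟦ b Fin.≟ 0ᶠ ⟧ ℤ.+ -1ℤ ℤ.* ⟦ s +ᶠ b Fin.≟ 0ᶠ ⟧
      ≡⟨ cong₂ (λ y z → y ℤ.+ -1ℤ ℤ.* z)
           (⟦⟧-cong (λ b≡0 → trans (sym (+ᶠ-identityʳ a)) (trans (cong (a +ᶠ_) (sym b≡0)) a+b≡0))
                    (λ a≡0 → trans (sym (+ᶠ-identityˡ b)) (trans (cong (_+ᶠ b) (sym a≡0)) a+b≡0))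
                    (b Fin.≟ 0ᶠ) (a Fin.≟ 0ᶠ))
           (⟦⟧-cong (λ s+b≡0 → +ᶠ-cancelʳ a s b (trans a+b≡0 (sym s+b≡0)))
                    (λ a≡s → trans (cong (_+ᶠ b) (sym a≡s)) a+b≡0)
                    (s +ᶠ b Fin.≟ 0ᶠ) (a Fin.≟ s)) ⟩
    ⟦ a Fin.≟ 0ᶠ ⟧ ℤ.+ -1ℤ ℤ.* ⟦ a Fin.≟ s ⟧
      ≡⟨ minus ⟦ a Fin.≟ 0ᶠ ⟧ ⟦ a Fin.≟ s ⟧ ⟩
    ⟦ a Fin.≟ 0ᶠ ⟧ ℤ.- ⟦ a Fin.≟ s ⟧ ∎
    where
    open ≡-Reasoning
    minus : ∀ i j → i ℤ.+ -1ℤ ℤ.* j ≡ i ℤ.- j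
    minus = solve-∀

  module _ {n : ℕ} {P : Pred (Vec (𝔽 p) n) 0ℓ} (P? : Decidable P) (P0 : P 0⃗) (s : 𝔽 p) (u : Vec (𝔽 p) n) where

    private
      f = characteristic (λ x → P? x ×-dec ¬? (x ≟⃗ 0⃗))
      h = shiftDifference s

    coordinate-indicator : ∀ x →
      ⟦ ¬? (x ≟⃗ 0⃗) ⟧ ℤ.* ⟦ ¬? (s *ᶠ f x +ᶠ u · x Fin.≟ 0ᶠ) ⟧ ≡
      ⟦ ¬? (u · x Fin.≟ 0ᶠ) ⟧ ℤ.+ (⟦ P? x ⟧ ℤ.* h (u · x) ℤ.+ -1ℤ ℤ.* (⟦ x ≟⃗ 0⃗ ⟧ ℤ.* h 0ᶠ))
    coordinate-indicator x with x ≟⃗ 0⃗ | P? x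
    ... | yes refl | no ¬p = contradiction P0 ¬p
    ... | yes refl | yes _
      rewrite ·-zeroʳ u | ⟦⟧-false (λ 0≢0 → 0≢0 refl) (¬? (0ᶠ {p} Fin.≟ 0ᶠ)) = cancel (h 0ᶠ)
      where
      cancel : ∀ z → 0ℤ ≡ 0ℤ ℤ.+ (1ℤ ℤ.* z ℤ.+ -1ℤ ℤ.* (1ℤ ℤ.* z))
      cancel = solve-∀
    ... | no _ | yes _
      rewrite *ᶠ-identityʳ s | ⟦⟧-¬ (s +ᶠ u · x Fin.≟ 0ᶠ) | ⟦⟧-¬ (u · x Fin.≟ 0ᶠ) =
      rearrange ⟦ s +ᶠ u · x Fin.≟ 0ᶠ ⟧ ⟦ u · x Fin.≟ 0ᶠ ⟧ (h 0ᶠ)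
      where
      rearrange : ∀ i j z → 1ℤ ℤ.* (1ℤ ℤ.+ -1ℤ ℤ.* i) ≡
        (1ℤ ℤ.+ -1ℤ ℤ.* j) ℤ.+ (1ℤ ℤ.* (j ℤ.+ -1ℤ ℤ.* i) ℤ.+ -1ℤ ℤ.* (0ℤ ℤ.* z))
      rearrange = solve-∀
    ... | no _ | no _
      rewrite *ᶠ-zeroʳ s | +ᶠ-identityˡ (u · x) = drop ⟦ ¬? (u · x Fin.≟ 0ᶠ) ⟧ (h (u · x)) (h 0ᶠ)
      where
      drop : ∀ i y z → 1ℤ ℤ.* i ≡ i ℤ.+ (0ℤ ℤ.* y ℤ.+ -1ℤ ℤ.* (0ℤ ℤ.* z))
      drop = solve-∀

    weight-formula :
      + wt (codeword f s u) ≡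
      sumᵛ (λ x → ⟦ ¬? (u · x Fin.≟ 0ᶠ) ⟧) ℤ.+ (sumᵛ (λ x → ⟦ P? x ⟧ ℤ.* h (u · x)) ℤ.+ -1ℤ ℤ.* h 0ᶠ)
    weight-formula = begin
      + wt (codeword f s u)
        ≡⟨ wt-codeword f s u ⟩
      sumᵛ (λ x → ⟦ ¬? (x ≟⃗ 0⃗) ⟧ ℤ.* ⟦ ¬? (s *ᶠ f x +ᶠ u · x Fin.≟ 0ᶠ) ⟧)
        ≡⟨ sumᵛ-cong coordinate-indicator ⟩
      sumᵛ (λ x → ⟦ ¬? (u · x Fin.≟ 0ᶠ) ⟧ ℤ.+ (⟦ P? x ⟧ ℤ.* h (u · x) ℤ.+ -1ℤ ℤ.* (⟦ x ≟⃗ 0⃗ ⟧ ℤ.* h 0ᶠ)))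
        ≡⟨ sumᵛ-+ (λ x → ⟦ ¬? (u · x Fin.≟ 0ᶠ) ⟧) _ ⟩
      S ℤ.+ sumᵛ (λ x → ⟦ P? x ⟧ ℤ.* h (u · x) ℤ.+ -1ℤ ℤ.* (⟦ x ≟⃗ 0⃗ ⟧ ℤ.* h 0ᶠ))
        ≡⟨ cong (ℤ._+_ S) (sumᵛ-+ (λ x → ⟦ P? x ⟧ ℤ.* h (u · x)) _) ⟩
      S ℤ.+ (D ℤ.+ sumᵛ {n = n} (λ x → -1ℤ ℤ.* (⟦ x ≟⃗ 0⃗ ⟧ ℤ.* h 0ᶠ)))
        ≡⟨ cong (λ z → S ℤ.+ (D ℤ.+ z)) (trans
             (sym (*-distribˡ-sumᵛ {n = n} -1ℤ (λ x → ⟦ x ≟⃗ 0⃗ ⟧ ℤ.* h 0ᶠ)))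
             (cong (-1ℤ ℤ.*_) (sumᵛ-point {n = n} (λ _ → h 0ᶠ) 0⃗))) ⟩
      S ℤ.+ (D ℤ.+ -1ℤ ℤ.* h 0ᶠ) ∎
      where
      open ≡-Reasoning
      S = sumᵛ (λ x → ⟦ ¬? (u · x Fin.≟ 0ᶠ) ⟧)
      D = sumᵛ (λ x → ⟦ P? x ⟧ ℤ.* h (u · x))

  -- The number of nonzero residues.
  sum-nonzero : sum (λ a → ⟦ ¬? (a Fin.≟ 0ᶠ {p}) ⟧) ≡ + (p ∸ 1)
  sum-nonzero = begin
    sum (λ a → ⟦ ¬? (a Fin.≟ 0ᶠ {p}) ⟧)
      ≡⟨ sum-cong-≗ (λ a → ⟦⟧-¬ (a Fin.≟ 0ᶠ {p})) ⟩
    sum (λ a → 1ℤ ℤ.+ -1ℤ ℤ.* ⟦ a Fin.≟ 0ᶠ {p} ⟧)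
      ≡⟨ ∑-distrib-+ (λ _ → 1ℤ) (λ a → -1ℤ ℤ.* ⟦ a Fin.≟ 0ᶠ {p} ⟧) ⟩
    sum {p} (λ _ → 1ℤ) ℤ.+ sum (λ a → -1ℤ ℤ.* ⟦ a Fin.≟ 0ᶠ {p} ⟧)
      ≡⟨ cong₂ ℤ._+_ (sum-const p 1ℤ) (trans
           (sym (*-distribˡ-sum -1ℤ (λ a → ⟦ a Fin.≟ 0ᶠ {p} ⟧))) (cong (-1ℤ ℤ.*_) (sum-indicator (0ᶠ {p})))) ⟩
    + p ℤ.* 1ℤ ℤ.+ -1ℤ
      ≡⟨ cong (λ q → + q ℤ.* 1ℤ ℤ.+ -1ℤ) (ℕ.suc-pred p) ⟨
    + suc (p ∸ 1) ℤ.* 1ℤ ℤ.+ -1ℤ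
      ≡⟨ cong (λ z → z ℤ.* 1ℤ ℤ.+ -1ℤ) (ℤ.pos-+ 1 (p ∸ 1)) ⟩
    (1ℤ ℤ.+ + (p ∸ 1)) ℤ.* 1ℤ ℤ.+ -1ℤ
      ≡⟨ simplify (+ (p ∸ 1)) ⟩
    + (p ∸ 1) ∎
    where
    open ≡-Reasoning
    simplify : ∀ q → (1ℤ ℤ.+ q) ℤ.* 1ℤ ℤ.+ -1ℤ ≡ q
    simplify = solve-∀

  sumᵛ-linear-nonzero : Prime p → 1 ≤ n → (u : Vec (𝔽 p) n) → u ≢ 0⃗ →
    sumᵛ (λ x → ⟦ ¬? (u · x Fin.≟ 0ᶠ) ⟧) ≡ + ((p ∸ 1) * p ^ (n ∸ 1))
  sumᵛ-linear-nonzero {n = suc n} pr _ u u≢0 = begin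
    sumᵛ (λ x → ⟦ ¬? (u · x Fin.≟ 0ᶠ) ⟧)
      ≡⟨ sumᵛ-cong (λ x → cong (λ a → ⟦ ¬? (a Fin.≟ 0ᶠ) ⟧) (sym (+ᶠ-identityˡ (u · x)))) ⟩
    sumᵛ (λ x → ⟦ ¬? (0ᶠ +ᶠ u · x Fin.≟ 0ᶠ) ⟧)
      ≡⟨ sumᵛ-linear pr 0ᶠ u (λ a → ⟦ ¬? (a Fin.≟ 0ᶠ) ⟧) u≢0 ⟩
    + (p ^ n) ℤ.* sum (λ a → ⟦ ¬? (a Fin.≟ 0ᶠ {p}) ⟧)
      ≡⟨ cong (+ (p ^ n) ℤ.*_) sum-nonzero ⟩
    + (p ^ n) ℤ.* + (p ∸ 1)
      ≡⟨ ℤ.*-comm (+ (p ^ n)) (+ (p ∸ 1)) ⟩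
    + (p ∸ 1) ℤ.* + (p ^ n)
      ≡⟨ ℤ.pos-* (p ∸ 1) (p ^ n) ⟨
    + ((p ∸ 1) * p ^ n) ∎
    where open ≡-Reasoning

  module _ (pr : Prime p) (s : 𝔽 p) (s≢0 : s ≢ 0ᶠ) where

    private
      h = shiftDifference s
      Σh≡0 = sum-shiftDifference s

    below-prefixSums : ∀ τ → PrefixSums pr h Σh≡0 (below? τ)
    below-prefixSums unsaturated = nonzero-prefixSums pr h Σh≡0
    below-prefixSums saturated   = singleton-prefixSums pr h Σh≡0 -1ᶠ

    -- The prefix sum at the base point 0 is the factor of Φ that does not depend
    -- on b and δ: for nonzero prefixes h takes the value 1 at 0, and for the
    -- constant prefix the argument is -σ.
    Φ-factor : ∀ τ (v : Vec (𝔽 p) m) b δ →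
      (+ (p ^ b) ℤ.* δ ℤ.+ -1ℤ) ℤ.* PrefixSums.prefixSum (below-prefixSums τ) v 0ᶠ ≡ Φ τ s v b δ
    Φ-factor unsaturated v b δ = begin
      (+ (p ^ b) ℤ.* δ ℤ.+ -1ℤ) ℤ.* (E ℤ.* h 0ᶠ)
        ≡⟨ cong (λ z → (+ (p ^ b) ℤ.* δ ℤ.+ -1ℤ) ℤ.* (E ℤ.* z)) (shiftDifference-0 s≢0) ⟩
      (+ (p ^ b) ℤ.* δ ℤ.+ -1ℤ) ℤ.* (E ℤ.* 1ℤ)
        ≡⟨ regroup (+ (p ^ b) ℤ.* δ) E ⟩
      E ℤ.* (+ (p ^ b) ℤ.* δ ℤ.- 1ℤ) ∎
      where
      open ≡-Reasoning
      E = nonzero-eigenvalue v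
      regroup : ∀ x e → (x ℤ.+ -1ℤ) ℤ.* (e ℤ.* 1ℤ) ≡ e ℤ.* (x ℤ.- 1ℤ)
      regroup = solve-∀
    Φ-factor {m} saturated v b δ = cong ((+ (p ^ b) ℤ.* δ ℤ.+ -1ℤ) ℤ.*_)
      (trans
      (cong h (+ᶠ-identityˡ (v · Vec.replicate m -1ᶠ)))
      (shiftDifference-neg s {Σᶠ v} {v · Vec.replicate m -1ᶠ} (Σᶠ+·-1≡0 v)))

    sumᵛ-subIdeal : ∀ τ (m≤n : m ≤ n) (B : Subset n) → (∀ j → j ∈ B → m ≤ toℕ j) → ∀ u →
      let v = truncate m≤n u
      in sumᵛ (λ x → ⟦ subIdeal? τ m (fullIdeal m B) x ⟧ ℤ.* h (u · x)) ≡
         + (p ^ m) ℤ.* ⟦ v ≟⃗ 0⃗ ⟧ ℤ.+ Φ τ s v ∣ B ∣ ⟦ vanishesOn? B u ⟧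
    sumᵛ-subIdeal {m} {n} τ m≤n B B≥m u = begin
      sumᵛ (λ x → ⟦ subIdeal? τ m (fullIdeal m B) x ⟧ ℤ.* h (u · x))
        ≡⟨ sumᵛ-cong (λ x → trans
             (cong₂ ℤ._*_ (⟦subIdeal?⟧ pr τ m B x) (cong h (sym (+ᶠ-identityˡ (u · x)))))
             (distribute ⟦ box? full? m ⊥ x ⟧ ⟦ box? (below? τ) m B x ⟧ ⟦ box? (below? τ) m ⊥ x ⟧ (h′ x))) ⟩
      sumᵛ (λ x → a x ℤ.+ (b x ℤ.+ -1ℤ ℤ.* c x))
        ≡⟨ trans (sumᵛ-+ a _) (cong (ℤ._+_ (sumᵛ a))
             (trans (sumᵛ-+ b _) (cong (ℤ._+_ (sumᵛ b)) (sym (*-distribˡ-sumᵛ -1ℤ c))))) ⟩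
      sumᵛ a ℤ.+ (sumᵛ b ℤ.+ -1ℤ ℤ.* sumᵛ c)
        ≡⟨ cong₂ ℤ._+_ (sumᵛ-box⊥ full? (full-prefixSums pr h Σh≡0))
             (cong₂ (λ y z → y ℤ.+ -1ℤ ℤ.* z)
               (sumᵛ-box pr h Σh≡0 (below? τ) (below-prefixSums τ) m≤n B B≥m u 0ᶠ)
               (sumᵛ-box⊥ (below? τ) (below-prefixSums τ))) ⟩
      + (p ^ m) ℤ.* V ℤ.* h 0ᶠ ℤ.+ (K ℤ.* t ℤ.+ -1ℤ ℤ.* t)
        ≡⟨ cong (λ z → + (p ^ m) ℤ.* V ℤ.* z ℤ.+ (K ℤ.* t ℤ.+ -1ℤ ℤ.* t)) (shiftDifference-0 s≢0) ⟩
      + (p ^ m) ℤ.* V ℤ.* 1ℤ ℤ.+ (K ℤ.* t ℤ.+ -1ℤ ℤ.* t)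
        ≡⟨ collect (+ (p ^ m) ℤ.* V) K t ⟩
      + (p ^ m) ℤ.* V ℤ.+ (K ℤ.+ -1ℤ) ℤ.* t
        ≡⟨ cong (ℤ._+_ (+ (p ^ m) ℤ.* V)) (Φ-factor τ v ∣ B ∣ ⟦ vanishesOn? B u ⟧) ⟩
      + (p ^ m) ℤ.* V ℤ.+ Φ τ s v ∣ B ∣ ⟦ vanishesOn? B u ⟧ ∎
      where
      open ≡-Reasoning
      v = truncate m≤n u
      V = ⟦ v ≟⃗ 0⃗ ⟧
      K = + (p ^ ∣ B ∣) ℤ.* ⟦ vanishesOn? B u ⟧
      t = PrefixSums.prefixSum (below-prefixSums τ) v 0ᶠ
      h′ a b c : Vec (𝔽 p) n → ℤ
      h′ x = h (0ᶠ +ᶠ u · x)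
      a x = ⟦ box? full? m ⊥ x ⟧ ℤ.* h′ x
      b x = ⟦ box? (below? τ) m B x ⟧ ℤ.* h′ x
      c x = ⟦ box? (below? τ) m ⊥ x ⟧ ℤ.* h′ x
      sumᵛ-box⊥ : ∀ {Y : Pred (𝔽 p) 0ℓ} (Y? : Decidable Y) (tr : PrefixSums pr h Σh≡0 Y?) →
        sumᵛ (λ x → ⟦ box? Y? m ⊥ x ⟧ ℤ.* h′ x) ≡ PrefixSums.prefixSum tr v 0ᶠ
      sumᵛ-box⊥ Y? tr = begin
        sumᵛ (λ x → ⟦ box? Y? m ⊥ x ⟧ ℤ.* h′ x)
          ≡⟨ sumᵛ-box pr h Σh≡0 Y? tr m≤n ⊥ (λ j j∈⊥ → contradiction j∈⊥ ∉⊥) u 0ᶠ ⟩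
        + (p ^ ∣ ⊥ {n} ∣) ℤ.* ⟦ vanishesOn? ⊥ u ⟧ ℤ.* PrefixSums.prefixSum tr v 0ᶠ
          ≡⟨ cong₂ (λ e d → + (p ^ e) ℤ.* d ℤ.* PrefixSums.prefixSum tr v 0ᶠ) (∣⊥∣≡0 n)
               (⟦⟧-true (λ j j∈⊥ → contradiction j∈⊥ ∉⊥) (vanishesOn? ⊥ u)) ⟩
        1ℤ ℤ.* 1ℤ ℤ.* PrefixSums.prefixSum tr v 0ᶠ
          ≡⟨ ℤ.*-identityˡ (PrefixSums.prefixSum tr v 0ᶠ) ⟩
        PrefixSums.prefixSum tr v 0ᶠ ∎
      distribute : ∀ i j k z → (i ℤ.+ j ℤ.+ -1ℤ ℤ.* k) ℤ.* z ≡ i ℤ.* z ℤ.+ (j ℤ.* z ℤ.+ -1ℤ ℤ.* (k ℤ.* z))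
      distribute = solve-∀
      collect : ∀ x k t → x ℤ.* 1ℤ ℤ.+ (k ℤ.* t ℤ.+ -1ℤ ℤ.* t) ≡ x ℤ.+ (k ℤ.+ -1ℤ) ℤ.* t
      collect = solve-∀

lemma5p1 :
    (p : ℕ) .{{_ : NonZero p}} → Prime p → ¬ (2 ∣ p) →
    (m n : ℕ) → 1 ≤ m → (m<n : m < n) →
    (B : Subset n) → (∀ j → j ∈ B → m ≤ toℕ j) → 1 ≤ ∣ B ∣ →
    (τ : IdealType) →
    let b   = ∣ B ∣
        I   = fullIdeal {p} m B
        I?  = subIdeal? τ m I
        f   = characteristic (λ x → I? x ×-dec ¬? (x ≟⃗ 0⃗))
        c   = codeword f
        Q   = (p ∸ 1) * p ^ (n ∸ 1)
    in
      ((u : Vec (𝔽 p) n) → u ≢ 0⃗ → wt (c 0ᶠ u) ≡ Q)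
    × ((s : 𝔽 p) → s ≢ 0ᶠ → + wt (c s 0⃗) ≡ + card I? ℤ.- 1ℤ)
    × ((s : 𝔽 p) (u : Vec (𝔽 p) n) → s ≢ 0ᶠ → u ≢ 0⃗ →
        let v = truncate (<⇒≤ m<n) u
            δ = ⟦ vanishesOn? B u ⟧
        in + wt (c s u) ≡ + Q ℤ.- 1ℤ ℤ.+ + (p ^ m) ℤ.* ⟦ v ≟⃗ 0⃗ ⟧ ℤ.+ Φ τ s v b δ)
lemma5p1 p pr _ m n 1≤m m<n B B≥m _ τ = s=0 , u=0 , general
  where
  open ≡-Reasoning
  I? = subIdeal? τ m (fullIdeal {p} m B)
  f = characteristic (λ x → I? x ×-dec ¬? (x ≟⃗ 0⃗))
  Q = (p ∸ 1) * p ^ (n ∸ 1)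
  0∈I = 0⃗∈ideal pr τ m B

  nonzeros : ∀ u → u ≢ 0⃗ → sumᵛ (λ x → ⟦ ¬? (u · x Fin.≟ 0ᶠ) ⟧) ≡ + Q
  nonzeros = sumᵛ-linear-nonzero pr (ℕ.≤-trans 1≤m (<⇒≤ m<n))

  s=0 : ∀ u → u ≢ 0⃗ → wt (codeword f 0ᶠ u) ≡ Q
  s=0 u u≢0 = ℤ.+-injective (begin
    + wt (codeword f 0ᶠ u)
      ≡⟨ weight-formula I? 0∈I 0ᶠ u ⟩
    S ℤ.+ (sumᵛ (λ x → ⟦ I? x ⟧ ℤ.* shiftDifference 0ᶠ (u · x)) ℤ.+ -1ℤ ℤ.* shiftDifference 0ᶠ 0ᶠ)
      ≡⟨ cong₂ (λ y z → S ℤ.+ (y ℤ.+ -1ℤ ℤ.* z))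
           (trans (sumᵛ-cong λ x → trans
                    (cong (⟦ I? x ⟧ ℤ.*_) (shiftDifference-zero (u · x))) (ℤ.*-zeroʳ ⟦ I? x ⟧))
                  (trans (sumᵛ-const {p} n 0ℤ) (ℤ.*-zeroʳ (+ (p ^ n)))))
           (shiftDifference-zero 0ᶠ) ⟩
    S ℤ.+ 0ℤ
      ≡⟨ ℤ.+-identityʳ S ⟩
    S
      ≡⟨ nonzeros u u≢0 ⟩
    + Q ∎)
    where S = sumᵛ (λ x → ⟦ ¬? (u · x Fin.≟ 0ᶠ) ⟧)

  u=0 : ∀ s → s ≢ 0ᶠ → + wt (codeword f s 0⃗) ≡ + card I? ℤ.- 1ℤ
  u=0 s s≢0 = begin
    + wt (codeword f s 0⃗)
      ≡⟨ weight-formula I? 0∈I s (0⃗ {n = n}) ⟩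
    sumᵛ {n = n} (λ x → ⟦ ¬? (0⃗ · x Fin.≟ 0ᶠ) ⟧) ℤ.+
      (sumᵛ (λ x → ⟦ I? x ⟧ ℤ.* shiftDifference s (0⃗ · x)) ℤ.+ -1ℤ ℤ.* shiftDifference s 0ᶠ)
      ≡⟨ cong₂ ℤ._+_
           (trans (sumᵛ-cong {n = n} λ x → ⟦⟧-false (λ ≢0 → ≢0 (·-zeroˡ x)) (¬? (0⃗ · x Fin.≟ 0ᶠ)))
                  (trans (sumᵛ-const {p} n 0ℤ) (ℤ.*-zeroʳ (+ (p ^ n)))))
           (cong₂ (λ y z → y ℤ.+ -1ℤ ℤ.* z)
             (trans (sumᵛ-cong λ x → trans
                      (cong (⟦ I? x ⟧ ℤ.*_) (trans (cong (shiftDifference s) (·-zeroˡ x)) (shiftDifference-0 s≢0)))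
                      (ℤ.*-identityʳ ⟦ I? x ⟧))
                    (sym (card-sumᵛ I?)))
             (shiftDifference-0 s≢0)) ⟩
    0ℤ ℤ.+ (+ card I? ℤ.- 1ℤ)
      ≡⟨ ℤ.+-identityˡ _ ⟩
    + card I? ℤ.- 1ℤ ∎

  general : ∀ s u → s ≢ 0ᶠ → u ≢ 0⃗ →
    let v = truncate (<⇒≤ m<n) u
        δ = ⟦ vanishesOn? B u ⟧
    in + wt (codeword f s u) ≡ + Q ℤ.- 1ℤ ℤ.+ + (p ^ m) ℤ.* ⟦ v ≟⃗ 0⃗ ⟧ ℤ.+ Φ τ s v ∣ B ∣ δ
  general s u s≢0 u≢0 = begin
    + wt (codeword f s u)
      ≡⟨ weight-formula I? 0∈I s u ⟩
    sumᵛ (λ x → ⟦ ¬? (u · x Fin.≟ 0ᶠ) ⟧) ℤ.+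
      (sumᵛ (λ x → ⟦ I? x ⟧ ℤ.* shiftDifference s (u · x)) ℤ.+ -1ℤ ℤ.* shiftDifference s 0ᶠ)
      ≡⟨ cong₂ ℤ._+_ (nonzeros u u≢0) (cong₂ (λ y z → y ℤ.+ -1ℤ ℤ.* z)
           (sumᵛ-subIdeal pr s s≢0 τ (<⇒≤ m<n) B B≥m u) (shiftDifference-0 s≢0)) ⟩
    + Q ℤ.+ ((A ℤ.+ F) ℤ.+ -1ℤ)
      ≡⟨ regroup (+ Q) A F ⟩
    + Q ℤ.- 1ℤ ℤ.+ A ℤ.+ F ∎
    where
    v = truncate (<⇒≤ m<n) u
    A = + (p ^ m) ℤ.* ⟦ v ≟⃗ 0⃗ ⟧
    F = Φ τ s v ∣ B ∣ ⟦ vanishesOn? B u ⟧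
    regroup : ∀ q a f → q ℤ.+ ((a ℤ.+ f) ℤ.+ -1ℤ) ≡ q ℤ.- 1ℤ ℤ.+ a ℤ.+ f
    regroup = solve-∀
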